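{- Let $1\le i<j\le m$. For all sufficiently large positive integers $q$, the number $|M((\mathcal{B}_m^{\{x_i-x_j=1\}})_q)|$ of points $(x_1,\dots,x_m)\in\mathbb{Z}_q^m$ with $x_i=x_j+1$ that lie on no hyperplane $H'_q$ with $H'\in\mathcal{B}_m\setminus\{\{x_i-x_j=1\}\}$ equals $$(q-2m)^{m+i-j}(q-2m+1)^{j-i-1}.$$
   Context: For $m\ge1$, the Shi arrangement of type B is the set of affine hyperplanes in $\mathbb{R}^m$ $$\mathcal{B}_m=\{\{x_s=0\},\{x_s=1\}\mid s\in[m]\}\cup\{\{x_s\pm x_t=0\},\{x_s\pm x_t=1\}\mid 1\le s<t\le m\},$$ where $[m]=\{1,\dots,m\}$. For a positive integer $q$ and a hyperplane $H=\{a_1x_1+\dots+a_mx_m=b\}$ with integer coefficients, $H_q=\{x\in\mathbb{Z}_q^m : [a_1]_qx_1+\dots+[a_m]_qx_m=[b]_q\}$ is its reduction modulo $q$, with $\mathbb{Z}_q=\mathbb{Z}/q\mathbb{Z}$. For $H\in\mathcal{B}_m$, the restriction is $\mathcal{B}_m^H=\{H\cap H' : H'\in\mathcal{B}_m\setminus\{H\},\ H\cap H'\neq\emptyset\}$, and $|M((\mathcal{B}_m^H)_q)|$ denotes the number of points of $H_q$ not lying on any $H'_q$ with $H'\in\mathcal{B}_m\setminus\{H\}$ (the characteristic quasi-polynomial of the restriction). -}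

module Defs where

open import Data.Nat as ℕ using (ℕ; zero; suc)
open import Data.Nat.Divisibility as ℕD using (_∣?_)
open import Data.Integer as ℤ using (ℤ; +_; -[1+_]; ∣_∣)
open import Data.Integer.Properties as ℤP using ()
open import Data.Fin as Fin using (Fin; toℕ; _≟_)
open import Data.Vec as Vec using (Vec; []; _∷_; tabulate; zipWith; foldr)
open import Data.Vec.Properties using (≡-dec)
open import Data.List as List using (List; []; _∷_; concatMap; filter; length; allFin; upTo; _++_)
open import Data.Product using (_×_; _,_; proj₁; proj₂)
open import Data.Product.Properties using () renaming (≡-dec to ×-≡-dec)
open import Relation.Nullary using (Dec; yes; no; ¬_; ¬?)
open import Data.List.Relation.Unary.All using (All; all?)
open import Relation.Binary.PropositionalEquality using (_≡_)

-- An affine hyperplane  a₁x₁ + … + aₘxₘ = b  with integer coefficients,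
-- represented by its coefficient vector and right-hand side.
Hyperplane : ℕ → Set
Hyperplane m = Vec ℤ m × ℤ

e : {m : ℕ} → Fin m → Vec ℤ m
e s = tabulate λ k → if-eq k
  where
  if-eq : _ → ℤ
  if-eq k with k ≟ s
  ... | yes _ = + 1
  ... | no  _ = + 0

_⊕_ : {m : ℕ} → Vec ℤ m → Vec ℤ m → Vec ℤ m
_⊕_ = zipWith ℤ._+_

_⊖_ : {m : ℕ} → Vec ℤ m → Vec ℤ m → Vec ℤ m
_⊖_ = zipWith ℤ._-_

ordPairs : (m : ℕ) → List (Fin m × Fin m)
ordPairs m = concatMap (λ s → concatMap (λ t → keep s t) (allFin m)) (allFin m)
  where
  keep : Fin m → Fin m → List (Fin m × Fin m)
  keep s t with toℕ s ℕ.<? toℕ t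
  ... | yes _ = (s , t) ∷ []
  ... | no  _ = []

shiB : (m : ℕ) → List (Hyperplane m)
shiB m =
  concatMap (λ s → (e s , + 0) ∷ (e s , + 1) ∷ []) (allFin m)
  ++ concatMap (λ st → let s = proj₁ st ; t = proj₂ st in
        (e s ⊕ e t , + 0) ∷ (e s ⊕ e t , + 1) ∷
        (e s ⊖ e t , + 0) ∷ (e s ⊖ e t , + 1) ∷ []) (ordPairs m)

hypDec : {m : ℕ} → (H H' : Hyperplane m) → Dec (H ≡ H')
hypDec = ×-≡-dec (≡-dec ℤ._≟_) ℤ._≟_

shiBminus : (m : ℕ) → Hyperplane m → List (Hyperplane m)
shiBminus m H = filter (λ H' → ¬? (hypDec H' H)) (shiB m)

-- Points of ℤ_q^m, elements of ℤ_q represented by Fin q (residues 0..q-1).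
points : (q m : ℕ) → List (Vec (Fin q) m)
points q zero    = [] ∷ []
points q (suc m) = concatMap (λ x → List.map (x ∷_) (points q m)) (allFin q)

eval : {q m : ℕ} → Hyperplane m → Vec (Fin q) m → ℤ
eval (a , b) x = foldr _ ℤ._+_ (+ 0) (zipWith (λ aₖ xₖ → aₖ ℤ.* (+ toℕ xₖ)) a x) ℤ.- b

-- x ∈ H_q  :⇔  [a₁]x₁ + … + [aₘ]xₘ = [b] in ℤ_q  ⇔  q divides the integer value
_∈q_ : {q m : ℕ} → Vec (Fin q) m → Hyperplane m → Set
_∈q_ {q} x H = q ℕD.∣ ∣ eval H x ∣

∈q? : {q m : ℕ} → (x : Vec (Fin q) m) → (H : Hyperplane m) → Dec (x ∈q H)
∈q? {q} x H = q ∣? ∣ eval H x ∣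

avoidsAll? : {q m : ℕ} → (x : Vec (Fin q) m) → (Hs : List (Hyperplane m)) → Dec (All (λ H → ¬ (x ∈q H)) Hs)
avoidsAll? x Hs = all? (λ H → ¬? (∈q? x H)) Hs

charQP : (m : ℕ) → Hyperplane m → ℕ → ℕ
charQP m H q =
  length (filter (λ x → ∈q? x H) (filter (λ x → avoidsAll? x (shiBminus m H)) (points q m)))

hypDiff1 : {m : ℕ} → Fin m → Fin m → Hyperplane m
hypDiff1 i j = (e i ⊖ e j , + 1)

{-# OPTIONS --safe #-}
-- Write q = 2n + c with c ≤ 1 and put the letter s on position min (x_s , q - x_s), with a sign telling the half
-- of ℤ_q in which x_s lies. The hyperplanes say that positions are distinct and that neighbouring positions carry
-- letters increasing for 1 < 2 < … < m < -m < … < -1; the equation x_i = x_j + 1 says that i and j, of equal sign,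
-- are neighbours in the wrong order. A letter k ∉ {i , j} can be deleted together with its position, which lowers
-- m and n by one and keeps q - 2m. Conversely, every letter blocks exactly one of the gaps into which k with a given
-- sign could be inserted, and different letters block different gaps, except that i and j block the same one if k has
-- their sign and i < k < j. Hence k can be inserted in q - 2m ways, or in q - 2m + 1 ways if i < k < j, and
-- induction on m down to the two letters i , j, which can be placed in q - 2m ways, gives the product.
module Submission where

open import Defs
open import Data.Nat using (ℕ; _≤_; _<_; _∸_; _+_; _*_)
open import Data.Integer as ℤ using (ℤ; +_)
open import Data.Fin using (Fin; toℕ)
open import Data.Product using (∃)
open import Relation.Binary.PropositionalEquality using (_≡_)

open import Data.Nat using (zero; suc; _^_; z≤n; s≤s; _<?_; _≤?_; >-nonZero)
import Data.Nat.Properties as ℕP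
open import Data.Nat.Divisibility using (_∣_; divides; >⇒∤; ∣-refl; _∣0)
import Data.Nat.Tactic.RingSolver as ℕSolver
open import Data.Integer using (-[1+_]; ∣_∣)
import Data.Integer.Properties as ℤP
open import Data.Integer.Tactic.RingSolver using (solve-∀)
open import Data.Fin using (zero; suc; punchIn; punchOut; fromℕ<)
import Data.Fin.Properties as FinP
open import Data.Fin.Properties using (0≢1+n; suc-injective; punchIn-injective; punchInᵢ≢i; punchIn-punchOut)
open import Data.Vec using (Vec; []; _∷_; lookup; tabulate; map; insertAt; foldr; zipWith)
open import Data.Vec.Properties
  using (lookup-map; lookup∘tabulate; tabulate∘lookup; tabulate-cong; insertAt-lookup; insertAt-punchIn; lookup-zipWith)
open import Data.List.Base as List using (List; []; _∷_; _++_; length; filter; upTo; concatMap; allFin;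
  cartesianProductWith)
open import Data.List.Properties using (length-map; length-++; length-upTo; filter-all)
open import Data.List.Membership.Propositional using (_∈_; lose; find)
open import Data.List.Membership.Propositional.Properties
open import Data.List.Membership.Propositional.Properties.WithK using (unique∧set⇒bag)
open import Data.List.Relation.Binary.BagAndSetEquality using (∼bag⇒↭)
open import Data.List.Relation.Binary.Permutation.Propositional.Properties using (↭-length)
open import Data.List.Relation.Unary.Any using (here; there)
open import Data.List.Relation.Unary.All as All using (All; []; _∷_)
open import Data.List.Relation.Unary.AllPairs using ([]; _∷_)
open import Data.List.Relation.Unary.Unique.Propositional using (Unique)
import Data.List.Relation.Unary.Unique.Propositional.Properties as Unique
open import Data.Product using (Σ; _×_; _,_; proj₁; proj₂; map₂)
open import Data.Product.Properties using (,-injective)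
open import Data.Sum using (_⊎_; inj₁; inj₂; [_,_]′)
open import Data.Empty using (⊥)
open import Function using (_∘_; id; mk⇔)
open import Relation.Nullary using (¬_; Dec; yes; no; contradiction; ¬?)
open import Relation.Nullary.Decidable using (map′; _×-dec_)
open import Relation.Binary.Definitions using (DecidableEquality; tri<; tri≈; tri>)
open import Relation.Binary.PropositionalEquality
  using (_≢_; refl; sym; trans; cong; cong₂; subst; subst₂; module ≡-Reasoning)

-- Finite cardinalities

-- The order of the signed letters is read off from the hyperplanes. As an upper letter on position
-- `p` stands for `x = q - p`, the equation `x_s - x_t = 1` with `s < t` makes `s` the right
-- neighbour of `t` in the lower half, but its left neighbour in the upper half; so positive letters
-- have to increase in label and negative ones to decrease. For letters in different halves,
-- `x_s + x_t = 1` puts an upper letter directly before a lower one, which is why all positive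
-- letters precede all negative ones. Transitivity of this order carries the induction: neighbours
-- of a deleted letter still ascend after closing up, and two ascending neighbours cannot both block
-- the gap between them. The pair `i`, `j` is the only one for which this fails, hence the only
-- source of the second factor. The delicate places are the ends of the range, where `x ≠ 0`,
-- `x ≠ 1` and the parity of `q` give the two halves different bounds. There, too, it is the ban on
-- an upper letter directly before a lower one that keeps deletion within the range.

record HasSize {A : Set} (P : A → Set) (n : ℕ) : Set where
  field
    -- Only the elements are listed, not their proofs of `P`, so an element with several proofs
    -- counts once.
    elements : List A
    unique   : Unique elements
    sound    : ∀ {x} → x ∈ elements → P x
    complete : ∀ {x} → P x → x ∈ elements
    size     : length elements ≡ n
open HasSize

private variable
  A B : Set
  P Q : A → Set
  k l m n : ℕ

HasSize-functional : HasSize P k → HasSize P l → k ≡ l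
HasSize-functional h h′ = trans (sym (size h)) (trans
  (↭-length (∼bag⇒↭ (unique∧set⇒bag (unique h) (unique h′)
    (mk⇔ (complete h′ ∘ sound h) (complete h ∘ sound h′)))))
  (size h′))

HasSize-resp : (∀ {x} → P x → Q x) → (∀ {x} → Q x → P x) → HasSize P n → HasSize Q n
HasSize-resp to from h = record
  { elements = elements h
  ; unique   = unique h
  ; sound    = to ∘ sound h
  ; complete = complete h ∘ from
  ; size     = size h
  }

HasSize-image : (f : A → B) → (∀ {x y} → f x ≡ f y → x ≡ y) →
  (∀ {x} → P x → Q (f x)) → (∀ {y} → Q y → ∃ λ x → P x × f x ≡ y) →
  HasSize P n → HasSize Q n
HasSize-image {Q = Q} f injective to onto h = record
  { elements = List.map f (elements h)
  ; unique   = Unique.map⁺ injective (unique h)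
  ; sound    = λ y∈ → let x , x∈ , y≡fx = ∈-map⁻ f y∈ in subst Q (sym y≡fx) (to (sound h x∈))
  ; complete = λ q → let x , p , fx≡y = onto q in subst (_∈ _) fx≡y (∈-map⁺ f (complete h p))
  ; size     = trans (length-map f (elements h)) (size h)
  }

HasSize-⊎ : (∀ {x} → P x → ¬ Q x) →
  HasSize P k → HasSize Q l → HasSize (λ x → P x ⊎ Q x) (k + l)
HasSize-⊎ disjoint h h′ = record
  { elements = elements h ++ elements h′
  ; unique   = Unique.++⁺ (unique h) (unique h′) λ (x∈ , x∈′) → disjoint (sound h x∈) (sound h′ x∈′)
  ; sound    = [ inj₁ ∘ sound h , inj₂ ∘ sound h′ ]′ ∘ ∈-++⁻ (elements h)
  ; complete = [ ∈-++⁺ˡ ∘ complete h , ∈-++⁺ʳ (elements h) ∘ complete h′ ]′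
  ; size     = trans (length-++ (elements h)) (cong₂ _+_ (size h) (size h′))
  }

HasSize-Σ : {R : A → B → Set} → HasSize P k → (∀ {x} → P x → HasSize (R x) l) →
  HasSize (λ (x , y) → P x × R x y) (k * l)
HasSize-Σ {A = A} {B = B} {P = P} {l = l} {R = R} h fibre =
  subst (HasSize _) (cong (_* l) (size h))
    (HasSize-resp (λ (x∈ , r) → sound h x∈ , r) (λ (p , r) → complete h p , r)
      (go (elements h) (unique h) (All.tabulate (sound h))))
  where
  go : (xs : List A) → Unique xs → All P xs → HasSize (λ (x , y) → x ∈ xs × R x y) (length xs * l)
  go [] _ _ = record { elements = [] ; unique = [] ; sound = λ () ; complete = λ { (() , _) } ; size = refl }
  go (x ∷ xs) (x∉xs ∷ xs!) (p ∷ ps) =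
    HasSize-resp [ (λ { (refl , r) → here refl , r }) , (λ (x∈ , r) → there x∈ , r) ]′
      (λ { (here refl , r) → inj₁ (refl , r) ; (there x∈ , r) → inj₂ (x∈ , r) })
      (HasSize-⊎ {P = λ (y , z) → y ≡ x × R y z} (λ { (refl , _) (x∈ , _) → All.lookup x∉xs x∈ refl })
        (HasSize-image (x ,_) (proj₂ ∘ ,-injective) (refl ,_) (λ { (refl , r) → _ , r , refl }) (fibre p))
        (go xs xs! ps))

HasSize-interval : ∀ a n → HasSize (λ x → a ≤ x × x < a + n) n
HasSize-interval a n = HasSize-image (λ x → a + x) (ℕP.+-cancelˡ-≡ a _ _)
  (λ {x} x<n → ℕP.m≤m+n a x , ℕP.+-monoʳ-< a x<n)
  (λ {y} (a≤y , y<a+n) → y ∸ a ,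
    ℕP.+-cancelˡ-< a _ _ (subst (_< a + n) (sym (ℕP.m+[n∸m]≡n a≤y)) y<a+n) , ℕP.m+[n∸m]≡n a≤y)
  (record { elements = upTo n ; unique = Unique.upTo⁺ n ; sound = ∈-upTo⁻ ; complete = ∈-upTo⁺ ; size = length-upTo n })

length-filter-≢ : (_≟_ : DecidableEquality A) {x : A} {xs : List A} → Unique xs → x ∈ xs →
  suc (length (filter (λ y → ¬? (x ≟ y)) xs)) ≡ length xs
length-filter-≢ _≟_ {x} (x∉xs ∷ _) (here refl) with x ≟ x
... | yes _   = cong (suc ∘ length) (filter-all _ x∉xs)
... | no x≢x = contradiction refl x≢x
length-filter-≢ _≟_ {x} {y ∷ _} (y∉xs ∷ xs!) (there x∈xs) with x ≟ y
... | yes refl = contradiction refl (All.lookup y∉xs x∈xs)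
... | no _     = cong suc (length-filter-≢ _≟_ xs! x∈xs)

HasSize-remove : DecidableEquality A → {x : A} → P x → HasSize P (suc n) → HasSize (λ y → P y × x ≢ y) n
HasSize-remove _≟_ {x} p h = record
  { elements = filter ≢x? (elements h)
  ; unique   = Unique.filter⁺ ≢x? (unique h)
  ; sound    = λ y∈ → let y∈′ , x≢y = ∈-filter⁻ ≢x? {xs = elements h} y∈ in sound h y∈′ , x≢y
  ; complete = λ (q , x≢y) → ∈-filter⁺ ≢x? (complete h q) x≢y
  ; size     = ℕP.suc-injective (trans (length-filter-≢ _≟_ (unique h) (complete h p)) (size h))
  }
  where ≢x? = λ y → ¬? (x ≟ y)

HasSize-avoid : DecidableEquality A → ∀ m (f : Fin m → A) → (∀ {s t} → f s ≡ f t → s ≡ t) →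
  (∀ s → P (f s)) → HasSize P (m + n) → HasSize (λ x → P x × (∀ s → f s ≢ x)) n
HasSize-avoid _≟_ zero    f injective p h = HasSize-resp (_, λ ()) proj₁ h
HasSize-avoid _≟_ (suc m) f injective p h =
  HasSize-resp (λ ((px , 0≢) , ≢) → px , λ { zero → 0≢ ; (suc s) → ≢ s })
    (λ (px , ≢) → (px , ≢ zero) , ≢ ∘ suc)
    (HasSize-avoid _≟_ m (f ∘ suc) (suc-injective ∘ injective)
      (λ s → p (suc s) , λ eq → 0≢1+n (injective eq))
      (HasSize-remove _≟_ (p zero) h))

-- Letters on positions

data Half : Set where
  lower upper : Half

Cell : Set
Cell = Half × ℕ

-- Signed letters in the order 1 < 2 < … < m < -m < … < -1, in which each block of consecutive occupied
-- positions is increasing (except for the pair i, j).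
infix 4 _≺_ _≺?_

data _≺_ : Half × ℕ → Half × ℕ → Set where
  lower  : ∀ {a b} → a < b → (lower , a) ≺ (lower , b)
  across : ∀ {a b} → (lower , a) ≺ (upper , b)
  upper  : ∀ {a b} → b < a → (upper , a) ≺ (upper , b)

≺-trans : ∀ {x y z} → x ≺ y → y ≺ z → x ≺ z
≺-trans (lower a<b) (lower b<c) = lower (ℕP.<-trans a<b b<c)
≺-trans (lower _)   across      = across
≺-trans across      (upper _)   = across
≺-trans (upper b<a) (upper c<b) = upper (ℕP.<-trans c<b b<a)

≺-irrefl : ∀ {x} → ¬ x ≺ x
≺-irrefl (lower a<a) = ℕP.<-irrefl refl a<a
≺-irrefl (upper a<a) = ℕP.<-irrefl refl a<a

_≺?_ : ∀ x y → Dec (x ≺ y)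
(lower , a) ≺? (lower , b) = map′ lower (λ { (lower a<b) → a<b }) (a <? b)
(lower , a) ≺? (upper , b) = yes across
(upper , a) ≺? (lower , b) = no λ ()
(upper , a) ≺? (upper , b) = map′ upper (λ { (upper b<a) → b<a }) (b <? a)

≮⇒≻ : ∀ {h a h′ b} → a ≢ b → ¬ (h , a) ≺ (h′ , b) → (h′ , b) ≺ (h , a)
≮⇒≻ {lower} {h′ = lower} a≢b ≮ = lower (ℕP.≤∧≢⇒< (ℕP.≮⇒≥ (≮ ∘ lower)) (a≢b ∘ sym))
≮⇒≻ {lower} {h′ = upper} a≢b ≮ = contradiction across ≮
≮⇒≻ {upper} {h′ = lower} a≢b ≮ = across
≮⇒≻ {upper} {h′ = upper} a≢b ≮ = upper (ℕP.≤∧≢⇒< (ℕP.≮⇒≥ (≮ ∘ upper)) a≢b)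

-- Opening a position: `punchIn` on natural numbers

shift : ℕ → ℕ → ℕ
shift p r with r <? p
... | yes _ = r
... | no  _ = suc r

shift-view : ∀ p r → (r < p × shift p r ≡ r) ⊎ (p ≤ r × shift p r ≡ suc r)
shift-view p r with r <? p
... | yes r<p = inj₁ (r<p , refl)
... | no  r≮p = inj₂ (ℕP.≮⇒≥ r≮p , refl)

shift-< : ∀ {p r} → r < p → shift p r ≡ r
shift-< {p} {r} r<p with shift-view p r
... | inj₁ (_ , eq)   = eq
... | inj₂ (p≤r , _)  = contradiction p≤r (ℕP.<⇒≱ r<p)

shift-≥ : ∀ {p r} → p ≤ r → shift p r ≡ suc r
shift-≥ {p} {r} p≤r with shift-view p r
... | inj₁ (r<p , _) = contradiction p≤r (ℕP.<⇒≱ r<p)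
... | inj₂ (_ , eq)  = eq

shift-≢ : ∀ p r → p ≢ shift p r
shift-≢ p r with shift-view p r
... | inj₁ (r<p , eq) = λ p≡ → ℕP.<⇒≢ r<p (sym (trans p≡ eq))
... | inj₂ (p≤r , eq) = λ p≡ → ℕP.<⇒≢ (s≤s p≤r) (trans p≡ eq)

shift-injective : ∀ p {r r′} → shift p r ≡ shift p r′ → r ≡ r′
shift-injective p {r} {r′} eq with shift-view p r | shift-view p r′
... | inj₁ (_ , e) | inj₁ (_ , e′) = trans (sym e) (trans eq e′)
... | inj₂ (_ , e) | inj₂ (_ , e′) = ℕP.suc-injective (trans (sym e) (trans eq e′))
... | inj₁ (r<p , e) | inj₂ (p≤r′ , e′) =
  contradiction (trans (sym e) (trans eq e′)) (ℕP.<⇒≢ (ℕP.<-≤-trans r<p (ℕP.m≤n⇒m≤1+n p≤r′)))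
... | inj₂ (p≤r , e) | inj₁ (r′<p , e′) =
  contradiction (trans (sym e′) (trans (sym eq) e)) (ℕP.<⇒≢ (ℕP.<-≤-trans r′<p (ℕP.m≤n⇒m≤1+n p≤r)))

shift-suc : ∀ {p r} → suc r ≢ p → shift p (suc r) ≡ suc (shift p r)
shift-suc {p} {r} 1+r≢p with shift-view p r
... | inj₁ (r<p , e) = trans (shift-< (ℕP.≤∧≢⇒< r<p 1+r≢p)) (cong suc (sym e))
... | inj₂ (p≤r , e) = trans (shift-≥ (ℕP.m≤n⇒m≤1+n p≤r)) (cong suc (sym e))

-- Since `shift p` misses `p`, opening this position creates no adjacency among the old ones. It
-- only tears `p - 1` and `p` apart, the case that `shift-suc` excludes.
shift-suc⁻ : ∀ p {r r′} → shift p r′ ≡ suc (shift p r) → r′ ≡ suc r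
shift-suc⁻ p {r} {r′} eq with suc r ℕP.≟ p
... | no 1+r≢p = shift-injective p (trans eq (sym (shift-suc 1+r≢p)))
... | yes refl = contradiction (sym (trans eq (cong suc (shift-< ℕP.≤-refl)))) (shift-≢ p r′)

shift≡suc⁻ : ∀ {p r} → shift p r ≡ suc p → r ≡ p
shift≡suc⁻ {p} eq = shift-injective p (trans eq (sym (shift-≥ ℕP.≤-refl)))

≡suc-shift⁻ : ∀ {p r : ℕ} → p ≡ suc (shift p r) → p ≡ suc r
≡suc-shift⁻ {suc p} eq = cong suc (shift-injective (suc p) (trans (shift-< ℕP.≤-refl) (ℕP.suc-injective eq)))

shift-onto : ∀ {p r} → p ≢ r → ∃ λ r′ → shift p r′ ≡ r
shift-onto {p} {r} p≢r with r <? p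
... | yes r<p = r , shift-< r<p
shift-onto {p} {zero}  p≢r | no r≮p = contradiction (ℕP.n≤0⇒n≡0 (ℕP.≮⇒≥ r≮p)) p≢r
shift-onto {p} {suc r} p≢r | no r≮p = r , shift-≥ (ℕP.≤-pred (ℕP.≤∧≢⇒< (ℕP.≮⇒≥ r≮p) p≢r))

shiftCell : ℕ → Cell → Cell
shiftCell p = map₂ (shift p)

half : Cell → Half
half = proj₁

pos : Cell → ℕ
pos = proj₂

shiftCell-injective : ∀ p {u v} → shiftCell p u ≡ shiftCell p v → u ≡ v
shiftCell-injective p eq = cong₂ _,_ (cong half eq) (shift-injective p (cong pos eq))

-- For q = 2n + c with c ≤ 1, the residues 2 ≤ x < q correspond to the cells in range:
-- (lower , p) is x = p and (upper , p) is x = q - p.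
InRange : (c n : ℕ) → Cell → Set
InRange c n (lower , p) = 2 ≤ p × p ≤ n
InRange c n (upper , p) = 1 ≤ p × p < n + c

-- x_i = x_j + 1, for x_i and x_j in the same half.
Linked : Cell → Cell → Set
Linked (lower , p) (lower , r) = p ≡ suc r
Linked (upper , p) (upper , r) = r ≡ suc p
Linked _           _           = ⊥

Ascending : ℕ → Cell → ℕ → Cell → Set
Ascending a u b v = pos v ≡ suc (pos u) → (half u , a) ≺ (half v , b)

-- The four hyperplanes of a pair at once: for residues `x`, `y` with labels `a < b`, distinct
-- positions exclude `x ± y = 0`, and the two ascents exclude `x + y = 1` and `x - y = 1`.
Compatible : ℕ → Cell → ℕ → Cell → Set
Compatible a u b v = pos u ≢ pos v × Ascending a u b v × Ascending b v a u

Compatible-sym : ∀ {a u b v} → Compatible a u b v → Compatible b v a u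
Compatible-sym (u≢v , asc , asc′) = u≢v ∘ sym , asc′ , asc

-- The gap p precedes position p. The occupant (b , v) excludes the signed letter x from exactly one of
-- the two gaps next to it.
blocked : Half × ℕ → ℕ → Cell → ℕ
blocked x b (h , r) with (h , b) ≺? x
... | yes _ = r
... | no  _ = suc r

blocked-view : ∀ x b v → ((half v , b) ≺ x × blocked x b v ≡ pos v) ⊎ (¬ (half v , b) ≺ x × blocked x b v ≡ suc (pos v))
blocked-view x b (h , r) with (h , b) ≺? x
... | yes lt = inj₁ (lt , refl)
... | no  ≮  = inj₂ (≮ , refl)

-- Compatibility with an inserted letter

module _ {a : ℕ} {h : Half} {p b : ℕ} (v : Cell) (a≢b : a ≢ b) where

  unblocked⇒≻ : blocked (h , a) b v ≢ p → pos v ≡ p → (h , a) ≺ (half v , b)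
  unblocked⇒≻ ≢p eq with blocked-view (h , a) b v
  ... | inj₁ (_ , e) = contradiction (trans e eq) ≢p
  ... | inj₂ (≮ , _) = ≮⇒≻ (a≢b ∘ sym) ≮

  unblocked⇒≺ : blocked (h , a) b v ≢ p → p ≡ suc (pos v) → (half v , b) ≺ (h , a)
  unblocked⇒≺ ≢p eq with blocked-view (h , a) b v
  ... | inj₁ (lt , _) = lt
  ... | inj₂ (_ , e)  = contradiction (trans e (sym eq)) ≢p

  -- An old letter becomes a neighbour of the new one only from position `p`, which moves to
  -- `p + 1`, or from `p - 1`. In both cases it blocks the gap `p` precisely when the order would be
  -- wrong.
  unblocked⇒Compatible : blocked (h , a) b v ≢ p → Compatible a (h , p) b (shiftCell p v)
  unblocked⇒Compatible ≢p = shift-≢ p (pos v) , unblocked⇒≻ ≢p ∘ shift≡suc⁻ , unblocked⇒≺ ≢p ∘ ≡suc-shift⁻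

  Compatible⇒unblocked : Compatible a (h , p) b (shiftCell p v) → blocked (h , a) b v ≢ p
  Compatible⇒unblocked (_ , asc , asc′) eq with blocked-view (h , a) b v
  ... | inj₁ (lt , e) = ≺-irrefl (≺-trans lt (asc (trans (cong (shift p) v≡p) (shift-≥ ℕP.≤-refl))))
    where v≡p = trans (sym e) eq
  ... | inj₂ (≮ , e) with refl ← trans (sym eq) e = ≮ (asc′ (cong suc (sym (shift-< ℕP.≤-refl))))

Ascending-shift : ∀ p {a u b v} → Ascending a u b v → Ascending a (shiftCell p u) b (shiftCell p v)
Ascending-shift p asc = asc ∘ shift-suc⁻ p

Compatible-shift : ∀ p {a u b v} → Compatible a u b v → Compatible a (shiftCell p u) b (shiftCell p v)
Compatible-shift p (u≢v , asc , asc′) = u≢v ∘ shift-injective p , Ascending-shift p asc , Ascending-shift p asc′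

-- A pair that is separated by the new letter x is ascending by transitivity through x.
Ascending-unshift : ∀ {x h p a u b v} → x ≢ a → x ≢ b → blocked (h , x) a u ≢ p → blocked (h , x) b v ≢ p →
  Ascending a (shiftCell p u) b (shiftCell p v) → Ascending a u b v
Ascending-unshift {p = p} {u = u} {v = v} x≢a x≢b u-free v-free asc v≡1+u with pos v ℕP.≟ p
... | yes v≡p = ≺-trans (unblocked⇒≺ u x≢a u-free (trans (sym v≡p) v≡1+u)) (unblocked⇒≻ v x≢b v-free v≡p)
... | no  v≢p = asc (trans (cong (shift p) v≡1+u) (shift-suc (v≢p ∘ trans v≡1+u)))

Compatible-unshift : ∀ {x h p a u b v} → x ≢ a → x ≢ b → blocked (h , x) a u ≢ p → blocked (h , x) b v ≢ p →
  Compatible a (shiftCell p u) b (shiftCell p v) → Compatible a u b v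
Compatible-unshift {p = p} x≢a x≢b u-free v-free (u≢v , asc , asc′) =
  u≢v ∘ cong (shift p) , Ascending-unshift x≢a x≢b u-free v-free asc , Ascending-unshift x≢b x≢a v-free u-free asc′

-- A letter standing between the linked pair would have to come after the left one and before the
-- right one, although these two are in the wrong order. So no free gap separates them.
Linked-shift : ∀ {x h p a u b v} → a < b → x ≢ a → x ≢ b → blocked (h , x) a u ≢ p → blocked (h , x) b v ≢ p →
  Linked u v → Linked (shiftCell p u) (shiftCell p v)
Linked-shift {p = p} {u = lower , _} {v = lower , r} a<b x≢a x≢b u-free v-free refl with suc r ℕP.≟ p
... | no ≢p = shift-suc ≢p
... | yes refl
  with lower b<a ← ≺-trans (unblocked⇒≺ (lower , r) x≢b v-free refl) (unblocked⇒≻ (lower , suc r) x≢a u-free refl) =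
  contradiction b<a (ℕP.<-asym a<b)
Linked-shift {p = p} {u = upper , r} {v = upper , _} a<b x≢a x≢b u-free v-free refl with suc r ℕP.≟ p
... | no ≢p = shift-suc ≢p
... | yes refl
  with upper b<a ← ≺-trans (unblocked⇒≺ (upper , r) x≢a u-free refl) (unblocked⇒≻ (upper , suc r) x≢b v-free refl) =
  contradiction b<a (ℕP.<-asym a<b)

Linked-unshift : ∀ p {u v} → Linked (shiftCell p u) (shiftCell p v) → Linked u v
Linked-unshift p {lower , _} {lower , _} = shift-suc⁻ p
Linked-unshift p {upper , _} {upper , _} = shift-suc⁻ p

-- The ends of the range

r≤shift : ∀ p r → r ≤ shift p r
r≤shift p r with shift-view p r
... | inj₁ (_ , e) = ℕP.≤-reflexive (sym e)
... | inj₂ (_ , e) = ℕP.≤-trans (ℕP.n≤1+n r) (ℕP.≤-reflexive (sym e))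

shift≤1+r : ∀ p r → shift p r ≤ suc r
shift≤1+r p r with shift-view p r
... | inj₁ (_ , e) = ℕP.≤-trans (ℕP.≤-reflexive e) (ℕP.n≤1+n r)
... | inj₂ (_ , e) = ℕP.≤-reflexive e

module _ {c n : ℕ} where

  n+c≤1+n : c ≤ 1 → n + c ≤ suc n
  n+c≤1+n c≤1 = ℕP.≤-trans (ℕP.+-monoʳ-≤ n c≤1) (ℕP.≤-reflexive (ℕP.+-comm n 1))

  InRange-shift : ∀ p v → InRange c n v → InRange c (suc n) (shiftCell p v)
  InRange-shift p (lower , r) (2≤r , r≤n) = ℕP.≤-trans 2≤r (r≤shift p r) , ℕP.≤-trans (shift≤1+r p r) (s≤s r≤n)
  InRange-shift p (upper , r) (1≤r , r<n) = ℕP.≤-trans 1≤r (r≤shift p r) , ℕP.≤-<-trans (shift≤1+r p r) (s≤s r<n)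

  -- Position 1 is open to upper letters only and, for `c = 0`, the last position to lower letters
  -- only. A deletion could push a letter of the other half beyond its bound only if the two were
  -- neighbours there, and then an upper letter would directly precede a lower one.
  InRange-unshift : ∀ {x h p b} v → c ≤ 1 → x ≢ b → blocked (h , x) b v ≢ p → InRange c (suc n) (h , p) →
    InRange c (suc n) (shiftCell p v) → InRange c n v
  InRange-unshift {h = h} {p} (lower , r) c≤1 x≢b free p-in (2≤s , s≤1+n) with shift-view p r
  InRange-unshift {h = h} {p} (lower , r) c≤1 x≢b free p-in (2≤s , s≤1+n) | inj₂ (p≤r , e) =
    2≤r (ℕP.≤-pred (subst (2 ≤_) e 2≤s)) , ℕP.≤-pred (subst (_≤ suc n) e s≤1+n)
    where
    1<p⊎ : ∀ {h} → InRange c (suc n) (h , p) → 2 ≤ p ⊎ h ≡ upper × 1 ≤ p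
    1<p⊎ {lower} (2≤p , _) = inj₁ 2≤p
    1<p⊎ {upper} (1≤p , _) = inj₂ (refl , 1≤p)
    2≤r : 1 ≤ r → 2 ≤ r
    2≤r 1≤r with 1<p⊎ p-in
    ... | inj₁ 2≤p = ℕP.≤-trans 2≤p p≤r
    ... | inj₂ (refl , 1≤p) with r ℕP.≟ p
    ...   | yes r≡p with () ← unblocked⇒≻ {h = upper} (lower , r) x≢b free r≡p
    ...   | no  r≢p = ℕP.≤-<-trans 1≤p (ℕP.≤∧≢⇒< p≤r (r≢p ∘ sym))
  InRange-unshift {h = h} {p} (lower , r) c≤1 x≢b free p-in (2≤s , s≤1+n) | inj₁ (r<p , e) =
    subst (2 ≤_) e 2≤s , ℕP.≤-pred (ℕP.≤-trans r<p (p≤1+n p-in))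
    where
    p≤1+n : ∀ {h} → InRange c (suc n) (h , p) → p ≤ suc n
    p≤1+n {lower} (_ , p≤) = p≤
    p≤1+n {upper} (_ , s≤s p≤) = ℕP.≤-trans p≤ (n+c≤1+n c≤1)
  InRange-unshift {h = h} {p} (upper , r) c≤1 x≢b free p-in (1≤s , s<) with shift-view p r
  InRange-unshift {h = h} {p} (upper , r) c≤1 x≢b free p-in (1≤s , s<) | inj₂ (p≤r , e) =
    ℕP.≤-trans (1≤p p-in) p≤r , ℕP.≤-pred (subst (_< suc n + c) e s<)
    where
    1≤p : ∀ {h} → InRange c (suc n) (h , p) → 1 ≤ p
    1≤p {lower} (2≤p , _) = ℕP.≤-trans (s≤s z≤n) 2≤p
    1≤p {upper} (1≤p , _) = 1≤p
  InRange-unshift {h = upper} {p} (upper , r) c≤1 x≢b free (_ , p<) (1≤s , s<) | inj₁ (r<p , e) =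
    subst (1 ≤_) e 1≤s , ℕP.≤-trans r<p (ℕP.≤-pred p<)
  InRange-unshift {h = lower} {p} (upper , r) c≤1 x≢b free (_ , p≤) (1≤s , s<) | inj₁ (r<p , e)
    with p ℕP.≟ suc r
  ... | yes p≡1+r with () ← unblocked⇒≺ {h = lower} (upper , r) x≢b free p≡1+r
  ... | no  p≢1+r = subst (1 ≤_) e 1≤s ,
    ℕP.≤-trans (ℕP.≤-pred (ℕP.≤-trans (ℕP.≤∧≢⇒< r<p (p≢1+r ∘ sym)) p≤)) (ℕP.m≤m+n n c)

  InRange-before : ∀ {h x b} v → (half v , b) ≺ (h , x) → InRange c n v → InRange c (suc n) (h , pos v)
  InRange-before (lower , _) (lower _) (2≤r , r≤n) = 2≤r , ℕP.m≤n⇒m≤1+n r≤n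
  InRange-before (lower , _) across    (2≤r , r≤n) = ℕP.<⇒≤ 2≤r , s≤s (ℕP.≤-trans r≤n (ℕP.m≤m+n n c))
  InRange-before (upper , _) (upper _) (1≤r , r<)  = 1≤r , ℕP.m≤n⇒m≤1+n r<

  InRange-after : ∀ {h x b} v → c ≤ 1 → ¬ (half v , b) ≺ (h , x) → InRange c n v → InRange c (suc n) (h , suc (pos v))
  InRange-after {lower} (lower , _) _   _  (2≤r , r≤n) = ℕP.m≤n⇒m≤1+n 2≤r , s≤s r≤n
  InRange-after {lower} (upper , _) c≤1 _  (1≤r , r<)  = s≤s 1≤r , ℕP.≤-trans r< (n+c≤1+n c≤1)
  InRange-after {upper} (lower , _) _   v⊀ _           = contradiction across v⊀
  InRange-after {upper} (upper , _) _   _  (1≤r , r<)  = s≤s z≤n , s≤s r<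

  -- This makes the count exact: every occupant costs a gap that would otherwise be admissible, even
  -- at the ends of the range.
  blocked-InRange : ∀ {h x b} v → c ≤ 1 → InRange c n v → InRange c (suc n) (h , blocked (h , x) b v)
  blocked-InRange {h} {x} {b} v c≤1 v-in with blocked-view (h , x) b v
  ... | inj₁ (v≺ , e) = subst (λ p → InRange c (suc n) (h , p)) (sym e) (InRange-before v v≺ v-in)
  ... | inj₂ (v⊀ , e) = subst (λ p → InRange c (suc n) (h , p)) (sym e) (InRange-after v c≤1 v⊀ v-in)

-- Configurations

HasSize-halves : ∀ {P : Half × A → Set} {k l} →
  HasSize (λ x → P (lower , x)) k → HasSize (λ x → P (upper , x)) l → HasSize P (k + l)
HasSize-halves {P = P} h h′ =
  HasSize-resp [ (λ { (refl , p) → p }) , (λ { (refl , p) → p }) ]′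
    (λ { {lower , _} p → inj₁ (refl , p) ; {upper , _} p → inj₂ (refl , p) })
    (HasSize-⊎ {P = λ x → proj₁ x ≡ lower × P x} {Q = λ x → proj₁ x ≡ upper × P x} (λ { (refl , _) (() , _) })
      (HasSize-image (lower ,_) (proj₂ ∘ ,-injective) (refl ,_) (λ { (refl , p) → _ , p , refl }) h)
      (HasSize-image (upper ,_) (proj₂ ∘ ,-injective) (refl ,_) (λ { (refl , p) → _ , p , refl }) h′))

lookup-ext : {xs ys : Vec A m} → (∀ s → lookup xs s ≡ lookup ys s) → xs ≡ ys
lookup-ext {xs = xs} {ys} eq = trans (sym (tabulate∘lookup xs)) (trans (tabulate-cong eq) (tabulate∘lookup ys))

punchIn-view : ∀ (k t : Fin (suc m)) → t ≡ k ⊎ ∃ λ s → punchIn k s ≡ t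
punchIn-view k t with k FinP.≟ t
... | yes k≡t = inj₁ (sym k≡t)
... | no  k≢t = inj₂ (punchOut k≢t , punchIn-punchOut k≢t)

Unexceptional : (i j s t : Fin m) → Set
Unexceptional i j s t = s ≢ t × ¬ (s ≡ i × t ≡ j) × ¬ (s ≡ j × t ≡ i)

-- Labels are arbitrary numbers because a deletion leaves holes among them. For the exceptional pair
-- `linked` takes the place of compatibility; it also makes their positions distinct.
record Valid (c n : ℕ) (lab : Fin m → ℕ) (i j : Fin m) (f : Fin m → Cell) : Set where
  field
    inRange    : ∀ s → InRange c n (f s)
    compatible : ∀ {s t} → Unexceptional i j s t → Compatible (lab s) (f s) (lab t) (f t)
    linked     : Linked (f i) (f j)
open Valid

Valid-cong : ∀ {c n lab i j} {f g : Fin m → Cell} → (∀ s → f s ≡ g s) → Valid c n lab i j f → Valid c n lab i j g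
Valid-cong {c = c} {n} {lab} f≗g v = record
  { inRange    = λ s → subst (InRange c n) (f≗g s) (inRange v s)
  ; compatible = λ {s} {t} ex → subst₂ (λ u w → Compatible (lab s) u (lab t) w) (f≗g s) (f≗g t) (compatible v ex)
  ; linked     = subst₂ Linked (f≗g _) (f≗g _) (linked v)
  }

record Fits (c n a : ℕ) (lab : Fin m → ℕ) (f : Fin m → Cell) (x : Cell) : Set where
  constructor _,_
  field
    gap-inRange : InRange c (suc n) x
    gap-free    : ∀ s → blocked (half x , a) (lab s) (f s) ≢ pos x
open Fits

module Insertion {c n : ℕ} (c≤1 : c ≤ 1) (lab : Fin (suc m) → ℕ) (lab-injective : ∀ {s t} → lab s ≡ lab t → s ≡ t)
  (k : Fin (suc m)) (i j : Fin m) (i<j : lab (punchIn k i) < lab (punchIn k j)) where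

  lab′ : Fin m → ℕ
  lab′ = lab ∘ punchIn k

  k≢punchIn : ∀ {s} → k ≢ punchIn k s
  k≢punchIn = punchInᵢ≢i k _ ∘ sym

  k≢lab′ : ∀ {s} → lab k ≢ lab′ s
  k≢lab′ eq = punchInᵢ≢i k _ (sym (lab-injective eq))

  -- Only the equations relating `f` and `g` are assumed, so that they serve insertion and deletion
  -- alike.
  module _ {x : Cell} {f : Fin (suc m) → Cell} {g : Fin m → Cell}
    (f-k : f k ≡ x) (f-punchIn : ∀ s → f (punchIn k s) ≡ shiftCell (pos x) (g s)) where

    insert-valid : Valid c n lab′ i j g → Fits c n (lab k) lab′ g x →
      Valid c (suc n) lab (punchIn k i) (punchIn k j) f
    insert-valid v (x-in , free) = record { inRange = range ; compatible = compat ; linked = link }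
      where
      range : ∀ t → InRange c (suc n) (f t)
      range t with punchIn-view k t
      ... | inj₁ refl       = subst (InRange c (suc n)) (sym f-k) x-in
      ... | inj₂ (s , refl) = subst (InRange c (suc n)) (sym (f-punchIn s)) (InRange-shift (pos x) (g s) (inRange v s))
      new : ∀ s → Compatible (lab k) (f k) (lab′ s) (f (punchIn k s))
      new s = subst₂ (λ u v → Compatible (lab k) u (lab′ s) v) (sym f-k) (sym (f-punchIn s))
        (unblocked⇒Compatible (g s) k≢lab′ (free s))
      compat : ∀ {s t} → Unexceptional (punchIn k i) (punchIn k j) s t → Compatible (lab s) (f s) (lab t) (f t)
      compat {s} {t} (s≢t , ij , ji) with punchIn-view k s | punchIn-view k t
      ... | inj₁ refl | inj₁ refl = contradiction refl s≢t
      ... | inj₁ refl | inj₂ (t , refl) = new t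
      ... | inj₂ (s , refl) | inj₁ refl = Compatible-sym (new s)
      ... | inj₂ (s , refl) | inj₂ (t , refl) =
        subst₂ (λ u v → Compatible (lab′ s) u (lab′ t) v) (sym (f-punchIn s)) (sym (f-punchIn t))
          (Compatible-shift (pos x) (compatible v (s≢t ∘ cong (punchIn k) ,
            (λ { (refl , refl) → ij (refl , refl) }) , λ { (refl , refl) → ji (refl , refl) })))
      link : Linked (f (punchIn k i)) (f (punchIn k j))
      link = subst₂ Linked (sym (f-punchIn i)) (sym (f-punchIn j))
        (Linked-shift i<j k≢lab′ k≢lab′ (free i) (free j) (linked v))

    module _ (v : Valid c (suc n) lab (punchIn k i) (punchIn k j) f) where

      delete-fits : Fits c n (lab k) lab′ g x
      delete-fits = subst (InRange c (suc n)) f-k (inRange v k) , λ s →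
        Compatible⇒unblocked (g s) k≢lab′
          (subst₂ (λ u v → Compatible (lab k) u (lab′ s) v) f-k (f-punchIn s)
            (compatible v (k≢punchIn , k≢punchIn ∘ proj₁ , k≢punchIn ∘ proj₁)))

      delete-valid : Valid c n lab′ i j g
      delete-valid = record
        { inRange = λ s → InRange-unshift (g s) c≤1 k≢lab′ (gap-free delete-fits s) (gap-inRange delete-fits)
            (subst (InRange c (suc n)) (f-punchIn s) (inRange v (punchIn k s)))
        ; compatible = λ {s} {t} (s≢t , ij , ji) →
            Compatible-unshift k≢lab′ k≢lab′ (gap-free delete-fits s) (gap-free delete-fits t)
              (subst₂ (λ u v → Compatible (lab′ s) u (lab′ t) v) (f-punchIn s) (f-punchIn t)
                (compatible v (s≢t ∘ punchIn-injective k s t ,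
                  (λ (s≡i , t≡j) → ij (punchIn-injective k s i s≡i , punchIn-injective k t j t≡j)) ,
                  (λ (s≡j , t≡i) → ji (punchIn-injective k s j s≡j , punchIn-injective k t i t≡i)))))
        ; linked = Linked-unshift (pos x) (subst₂ Linked (f-punchIn i) (f-punchIn j) (linked v))
        }

  insert : Vec Cell m × Cell → Vec Cell (suc m)
  insert (y , x) = insertAt (map (shiftCell (pos x)) y) k x

  lookup-insert : ∀ y x → lookup (insert (y , x)) k ≡ x
  lookup-insert y x = insertAt-lookup (map (shiftCell (pos x)) y) k x

  lookup-insert-punchIn : ∀ y x s → lookup (insert (y , x)) (punchIn k s) ≡ shiftCell (pos x) (lookup y s)
  lookup-insert-punchIn y x s = trans (insertAt-punchIn _ k x s) (lookup-map s _ y)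

  insert-injective : ∀ {a b} → insert a ≡ insert b → a ≡ b
  insert-injective {y , x} {y′ , x′} eq
    with refl ← trans (sym (lookup-insert y x)) (trans (cong (λ z → lookup z k) eq) (lookup-insert y′ x′)) =
    cong (_, x) (lookup-ext λ s → shiftCell-injective (pos x)
      (trans (sym (lookup-insert-punchIn y x s))
        (trans (cong (λ z → lookup z (punchIn k s)) eq) (lookup-insert-punchIn y′ x s))))

  insert-onto : ∀ {z} → Valid c (suc n) lab (punchIn k i) (punchIn k j) (lookup z) → ∃ λ a → insert a ≡ z
  insert-onto {z} v = (y , x) , lookup-ext same
    where
    x = lookup z k
    -- The letter `k` belongs to no exceptional pair, so nothing shares its position and all other
    -- positions lie in the image of `shift`.
    apart : ∀ s → pos x ≢ pos (lookup z (punchIn k s))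
    apart s = proj₁ (compatible v (k≢punchIn , k≢punchIn ∘ proj₁ , k≢punchIn ∘ proj₁))
    y = tabulate λ s → half (lookup z (punchIn k s)) , proj₁ (shift-onto (apart s))
    same : ∀ t → lookup (insert (y , x)) t ≡ lookup z t
    same t with punchIn-view k t
    ... | inj₁ refl = lookup-insert y x
    ... | inj₂ (s , refl) = trans (lookup-insert-punchIn y x s)
      (trans (cong (shiftCell (pos x)) (lookup∘tabulate _ s))
        (cong (half (lookup z (punchIn k s)) ,_) (proj₂ (shift-onto (apart s)))))

  -- Which cells fit depends on the smaller configuration; for a product it suffices that their
  -- number does not.
  insert-size : ∀ {N w} → HasSize (Valid c n lab′ i j ∘ lookup) N →
    (∀ {y} → Valid c n lab′ i j (lookup y) → HasSize (Fits c n (lab k) lab′ (lookup y)) w) →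
    HasSize (Valid c (suc n) lab (punchIn k i) (punchIn k j) ∘ lookup) (N * w)
  insert-size h fits = HasSize-image insert insert-injective
    (λ { {y , x} (v , fit) → insert-valid (lookup-insert y x) (lookup-insert-punchIn y x) v fit })
    (λ v → let (y , x) , eq = insert-onto v
               v′ = subst (Valid c (suc n) lab (punchIn k i) (punchIn k j) ∘ lookup) (sym eq) v
           in (y , x) , (delete-valid (lookup-insert y x) (lookup-insert-punchIn y x) v′ ,
                         delete-fits (lookup-insert y x) (lookup-insert-punchIn y x) v′) , eq)
    (HasSize-Σ h λ {y} → fits {y})

-- Counting the free gaps

Compatible⇒blocked-≢ : ∀ x {a u b v} → Compatible a u b v → blocked x a u ≢ blocked x b v
Compatible⇒blocked-≢ x {a} {u} {b} {v} (u≢v , asc , asc′) eq with blocked-view x a u | blocked-view x b v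
... | inj₁ (_ , e) | inj₁ (_ , e′) = u≢v (trans (sym e) (trans eq e′))
... | inj₂ (_ , e) | inj₂ (_ , e′) = u≢v (ℕP.suc-injective (trans (sym e) (trans eq e′)))
-- The common gap lies between the two: `v` directly precedes `u`, so `v ≺ u ≺ x`, although `v` does
-- not precede `x`.
... | inj₁ (u≺x , e) | inj₂ (v⊀x , e′) = v⊀x (≺-trans (asc′ (trans (sym e) (trans eq e′))) u≺x)
... | inj₂ (u⊀x , e) | inj₁ (v≺x , e′) = u⊀x (≺-trans (asc (trans (sym e′) (trans (sym eq) e))) v≺x)

blocked-≺ : ∀ {x b} v → (half v , b) ≺ x → blocked x b v ≡ pos v
blocked-≺ {x} {b} v v≺x with blocked-view x b v
... | inj₁ (_ , e)   = e
... | inj₂ (v⊀x , _) = contradiction v≺x v⊀x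

blocked-⊀ : ∀ {x b} v → ¬ (half v , b) ≺ x → blocked x b v ≡ suc (pos v)
blocked-⊀ {x} {b} v v⊀x with blocked-view x b v
... | inj₁ (v≺x , _) = contradiction v≺x v⊀x
... | inj₂ (_ , e)   = e

-- Exactly in this case the linked letters block the same gap, the one between them, and one more gap is left.
Between : Half → ℕ → ℕ → Cell → ℕ → Set
Between h l a u b = half u ≡ h × a < l × l < b

Linked⇒blocked-≢ : ∀ {h l a u b v} → l ≢ a → l ≢ b → Linked u v → ¬ Between h l a u b →
  blocked (h , l) a u ≢ blocked (h , l) b v
Linked⇒blocked-≢ {h} {l} {a} {u} {b} {v} l≢a l≢b uv ¬between eq
  with blocked-view (h , l) a u | blocked-view (h , l) b v
Linked⇒blocked-≢ {u = lower , _} {v = lower , r} _ _ refl _ eq | inj₁ (_ , e) | inj₁ (_ , e′) =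
  ℕP.1+n≢n (trans (sym e) (trans eq e′))
Linked⇒blocked-≢ {u = lower , _} {v = lower , r} _ _ refl _ eq | inj₂ (_ , e) | inj₂ (_ , e′) =
  ℕP.1+n≢n (trans (sym e) (trans eq e′))
-- These are the two outer gaps of the pair, which are two apart.
Linked⇒blocked-≢ {u = lower , _} {v = lower , r} _ _ refl _ eq | inj₂ (_ , e) | inj₁ (_ , e′) =
  ℕP.<⇒≢ (ℕP.m≤n⇒m≤1+n ℕP.≤-refl) (sym (trans (sym e) (trans eq e′)))
-- Only the inner gap can be common: for `l` in the same half, the right letter blocks it if `a < l`
-- and the left one if `l < b`.
Linked⇒blocked-≢ {u = lower , _} {v = lower , r} _ l≢b refl ¬between eq | inj₁ (lower a<l , e) | inj₂ (v⊀x , e′) =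
  ¬between (refl , a<l , ℕP.≤∧≢⇒< (ℕP.≮⇒≥ (v⊀x ∘ lower)) l≢b)
Linked⇒blocked-≢ {u = lower , _} {v = lower , r} _ l≢b refl ¬between eq | inj₁ (across , e) | inj₂ (v⊀x , e′) =
  v⊀x across
Linked⇒blocked-≢ {u = upper , r} {v = upper , _} _ _ refl _ eq | inj₁ (_ , e) | inj₁ (_ , e′) =
  ℕP.1+n≢n (sym (trans (sym e) (trans eq e′)))
Linked⇒blocked-≢ {u = upper , r} {v = upper , _} _ _ refl _ eq | inj₂ (_ , e) | inj₂ (_ , e′) =
  ℕP.1+n≢n (sym (trans (sym e) (trans eq e′)))
Linked⇒blocked-≢ {u = upper , r} {v = upper , _} _ _ refl _ eq | inj₁ (_ , e) | inj₂ (_ , e′) =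
  ℕP.<⇒≢ (ℕP.m≤n⇒m≤1+n ℕP.≤-refl) (trans (sym e) (trans eq e′))
Linked⇒blocked-≢ {u = upper , r} {v = upper , _} l≢a _ refl ¬between eq | inj₂ (u⊀x , e) | inj₁ (upper l<b , e′) =
  ¬between (refl , ℕP.≤∧≢⇒< (ℕP.≮⇒≥ (u⊀x ∘ upper)) (l≢a ∘ sym) , l<b)

Linked⇒blocked-≡ : ∀ {h l a u b v} → Linked u v → Between h l a u b → blocked (h , l) a u ≡ blocked (h , l) b v
Linked⇒blocked-≡ {u = lower , _} {v = lower , r} refl (refl , a<l , l<b) = trans
  (blocked-≺ (lower , suc r) (lower a<l))
  (sym (blocked-⊀ (lower , r) λ { (lower b<l) → ℕP.<-asym l<b b<l }))
Linked⇒blocked-≡ {u = upper , r} {v = upper , _} refl (refl , a<l , l<b) = trans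
  (blocked-⊀ (upper , r) λ { (upper l<a) → ℕP.<-asym a<l l<a })
  (sym (blocked-≺ (upper , suc r) (upper l<b)))

-- Without the index `j` the family is injective and still has the same values, so one element fewer
-- is lost.
HasSize-avoid-collision : DecidableEquality A → ∀ {n} (f : Fin m → A) {i j} → i ≢ j → f i ≡ f j →
  (∀ {s t} → s ≢ j → t ≢ j → f s ≡ f t → s ≡ t) →
  (∀ s → P (f s)) → HasSize P (m + n) → HasSize (λ x → P x × (∀ s → f s ≢ x)) (suc n)
HasSize-avoid-collision {m = suc m} {P = P} _≟_ {n} f {i} {j} i≢j fi≡fj injective p h =
  HasSize-resp (λ (px , ≢) → px , avoid ≢) (λ (px , ≢) → px , ≢ ∘ punchIn j)
    (HasSize-avoid _≟_ m (f ∘ punchIn j)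
      (punchIn-injective j _ _ ∘ injective (punchInᵢ≢i j _) (punchInᵢ≢i j _))
      (p ∘ punchIn j) (subst (HasSize P) (sym (ℕP.+-suc m n)) h))
  where
  avoid : ∀ {x} → (∀ s → f (punchIn j s) ≢ x) → ∀ t → f t ≢ x
  avoid ≢ t with punchIn-view j t
  ... | inj₂ (s , refl) = ≢ s
  ... | inj₁ refl with punchIn-view j i
  ...   | inj₁ i≡j = contradiction i≡j i≢j
  ...   | inj₂ (s , refl) = ≢ s ∘ trans fi≡fj

module _ {c r : ℕ} (c≤1 : c ≤ 1) {lab : Fin m → ℕ} {l : ℕ} (l≢lab : ∀ s → l ≢ lab s) {i j : Fin m}
  (i<j : lab i < lab j) {f : Fin m → Cell} (v : Valid c (m + r) lab i j f) where

  private
    blockedGap : Half → Fin m → ℕ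
    blockedGap h s = blocked (h , l) (lab s) (f s)

    i≢j : i ≢ j
    i≢j refl = ℕP.<-irrefl refl i<j

    -- Compatible letters never collide, so only the pair `i`, `j` is in question. The first
    -- alternative discards `j`, the second excludes the collision.
    blocked-injective : ∀ {h s t} → (s ≢ j × t ≢ j) ⊎ ¬ Between h l (lab i) (f i) (lab j) →
      blockedGap h s ≡ blockedGap h t → s ≡ t
    blocked-injective {h} {s} {t} _ _ with s FinP.≟ t
    blocked-injective {h} {s} {t} _ _ | yes s≡t = s≡t
    blocked-injective {h} {s} {t} ok eq | no s≢t
      with (s FinP.≟ i) ×-dec (t FinP.≟ j) | (s FinP.≟ j) ×-dec (t FinP.≟ i)
    ... | no ¬ij | no ¬ji = contradiction eq (Compatible⇒blocked-≢ (h , l) (compatible v (s≢t , ¬ij , ¬ji)))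
    blocked-injective (inj₁ (_ , t≢j)) eq | no _ | yes (refl , refl) | _ = contradiction refl t≢j
    blocked-injective (inj₁ (s≢j , _)) eq | no _ | no _ | yes (refl , refl) = contradiction refl s≢j
    blocked-injective (inj₂ ¬between) eq | no _ | yes (refl , refl) | _ =
      contradiction eq (Linked⇒blocked-≢ (l≢lab i) (l≢lab j) (linked v) ¬between)
    blocked-injective (inj₂ ¬between) eq | no _ | no _ | yes (refl , refl) =
      contradiction (sym eq) (Linked⇒blocked-≢ (l≢lab i) (l≢lab j) (linked v) ¬between)

    -- The surplus when all `m` letters block different gaps: the lower half offers `m + r` gaps,
    -- the upper one `m + r + c`.
    gaps : Half → ℕ
    gaps lower = r
    gaps upper = r + c

    range-size : ∀ h → HasSize (λ p → InRange c (suc (m + r)) (h , p)) (m + gaps h)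
    range-size lower = HasSize-resp (map₂ ℕP.≤-pred) (map₂ s≤s) (HasSize-interval 2 (m + r))
    range-size upper = subst (HasSize _) (ℕP.+-assoc m r c) (HasSize-interval 1 (m + r + c))

    fits-size : ∀ h → ¬ Between h l (lab i) (f i) (lab j) →
      HasSize (λ p → Fits c (m + r) l lab f (h , p)) (gaps h)
    fits-size h ¬between = HasSize-resp (λ (p-in , ≢) → p-in , ≢) (λ (p-in , ≢) → p-in , ≢)
      (HasSize-avoid ℕP._≟_ m (blockedGap h) (blocked-injective (inj₂ ¬between))
        (λ s → blocked-InRange (f s) c≤1 (inRange v s)) (range-size h))

    fits-size-collision : ∀ h → Between h l (lab i) (f i) (lab j) →
      HasSize (λ p → Fits c (m + r) l lab f (h , p)) (suc (gaps h))
    fits-size-collision h between = HasSize-resp (λ (p-in , ≢) → p-in , ≢) (λ (p-in , ≢) → p-in , ≢)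
      (HasSize-avoid-collision ℕP._≟_ (blockedGap h) i≢j (Linked⇒blocked-≡ (linked v) between)
        (λ s≢j t≢j → blocked-injective (inj₁ (s≢j , t≢j)))
        (λ s → blocked-InRange (f s) c≤1 (inRange v s)) (range-size h))

  fits-size-outside : ¬ (lab i < l × l < lab j) → HasSize (Fits c (m + r) l lab f) (r + (r + c))
  fits-size-outside outside = HasSize-halves (fits-size lower (outside ∘ proj₂)) (fits-size upper (outside ∘ proj₂))

  fits-size-between : lab i < l → l < lab j → HasSize (Fits c (m + r) l lab f) (suc (r + (r + c)))
  -- The collision needs the sign of `i`, so the extra gap arises in exactly one of the two halves.
  fits-size-between i<l l<j with half (f i) in eq
  ... | lower = HasSize-halves (fits-size-collision lower (eq , i<l , l<j)) (fits-size upper (¬between ∘ proj₁))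
    where
    ¬between : half (f i) ≢ upper
    ¬between eq′ with () ← trans (sym eq) eq′
  ... | upper = subst (HasSize _) (ℕP.+-suc r (r + c))
    (HasSize-halves (fits-size lower (¬between ∘ proj₁)) (fits-size-collision upper (eq , i<l , l<j)))
    where
    ¬between : half (f i) ≢ lower
    ¬between eq′ with () ← trans (sym eq) eq′

-- Induction on the number of letters

Increasing : (Fin m → ℕ) → Set
Increasing lab = ∀ {s t} → toℕ s < toℕ t → lab s < lab t

punchIn-mono-< : ∀ k {s t : Fin m} → toℕ s < toℕ t → toℕ (punchIn k s) < toℕ (punchIn k t)
punchIn-mono-< k {s} {t} s<t = FinP.≤∧≢⇒< (FinP.punchIn-mono-≤ k s t (ℕP.<⇒≤ s<t))
  λ eq → ℕP.<-irrefl (cong toℕ (punchIn-injective k s t eq)) s<t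

Increasing⇒injective : {lab : Fin m → ℕ} → Increasing lab → ∀ {s t} → lab s ≡ lab t → s ≡ t
Increasing⇒injective inc {s} {t} eq with FinP.<-cmp s t
... | tri< s<t _ _ = contradiction eq (ℕP.<⇒≢ (inc s<t))
... | tri≈ _ s≡t _ = s≡t
... | tri> _ _ t<s = contradiction (sym eq) (ℕP.<⇒≢ (inc t<s))

module _ {c : ℕ} (c≤1 : c ≤ 1) (r : ℕ) where

  private
    w : ℕ
    w = r + (r + c)

  -- The argument is the cell on the smaller of the two positions, which belongs to `j` in the lower
  -- half and to `i` in the upper half.
  linked-pair : Cell → Vec Cell 2
  linked-pair (lower , p) = (lower , suc p) ∷ (lower , p) ∷ []
  linked-pair (upper , p) = (upper , p) ∷ (upper , suc p) ∷ []

  linked-pair-size : ∀ {lab : Fin 2 → ℕ} → HasSize (Valid c (2 + r) lab zero (suc zero) ∘ lookup) w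
  linked-pair-size {lab} = HasSize-image linked-pair injective valid onto
    (HasSize-halves {P = First} (HasSize-interval 2 r) (HasSize-interval 1 (r + c)))
    where
    -- The upper bounds leave room for the second letter on position `p + 1`.
    First : Cell → Set
    First (lower , p) = 2 ≤ p × p < 2 + r
    First (upper , p) = 1 ≤ p × p < 1 + (r + c)
    injective : ∀ {x y} → linked-pair x ≡ linked-pair y → x ≡ y
    injective {lower , _} {lower , _} refl = refl
    injective {upper , _} {upper , _} refl = refl
    no-other : ∀ {s t : Fin 2} → ¬ Unexceptional zero (suc zero) s t
    no-other {zero}     {zero}     (s≢t , _) = s≢t refl
    no-other {zero}     {suc zero} (_ , ij , _) = ij (refl , refl)
    no-other {suc zero} {zero}     (_ , _ , ji) = ji (refl , refl)
    no-other {suc zero} {suc zero} (s≢t , _) = s≢t refl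
    valid : ∀ {x} → First x → Valid c (2 + r) lab zero (suc zero) (lookup (linked-pair x))
    valid {lower , p} (2≤p , p<) = record
      { inRange = λ { zero → ℕP.m≤n⇒m≤1+n 2≤p , p< ; (suc zero) → 2≤p , ℕP.<⇒≤ p< }
      ; compatible = λ e → contradiction e no-other
      ; linked = refl }
    valid {upper , p} (1≤p , p<) = record
      { inRange = λ { zero → 1≤p , ℕP.m≤n⇒m≤1+n p< ; (suc zero) → s≤s z≤n , s≤s p< }
      ; compatible = λ e → contradiction e no-other
      ; linked = refl }
    onto : ∀ {y} → Valid c (2 + r) lab zero (suc zero) (lookup y) → ∃ λ x → First x × linked-pair x ≡ y
    onto {(lower , _) ∷ (lower , p) ∷ []} v with refl ← linked v =
      (lower , p) , (proj₁ (inRange v (suc zero)) , proj₂ (inRange v zero)) , refl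
    onto {(lower , _) ∷ (upper , p) ∷ []} v with () ← linked v
    onto {(upper , _) ∷ (lower , p) ∷ []} v with () ← linked v
    onto {(upper , p) ∷ (upper , _) ∷ []} v with refl ← linked v =
      (upper , p) , (proj₁ (inRange v zero) , ℕP.≤-pred (proj₂ (inRange v (suc zero)))) , refl

  module _ {lab : Fin (suc m) → ℕ} (inc : Increasing lab) (k : Fin (suc m)) {i j : Fin m} (i<j : toℕ i < toℕ j) where

    private
      k≢ : ∀ s → lab k ≢ lab (punchIn k s)
      k≢ s eq = punchInᵢ≢i k s (sym (Increasing⇒injective inc eq))
      i<j′ = inc (punchIn-mono-< k i<j)
      open Insertion {n = m + r} c≤1 lab (Increasing⇒injective inc) k i j i<j′

    insert-outside : ∀ {N} → ¬ (lab (punchIn k i) < lab k × lab k < lab (punchIn k j)) →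
      HasSize (Valid c (m + r) (lab ∘ punchIn k) i j ∘ lookup) N →
      HasSize (Valid c (suc m + r) lab (punchIn k i) (punchIn k j) ∘ lookup) (N * w)
    insert-outside outside h = insert-size h λ v → fits-size-outside c≤1 k≢ i<j′ v outside

    insert-between : ∀ {N} → lab (punchIn k i) < lab k → lab k < lab (punchIn k j) →
      HasSize (Valid c (m + r) (lab ∘ punchIn k) i j ∘ lookup) N →
      HasSize (Valid c (suc m + r) lab (punchIn k i) (punchIn k j) ∘ lookup) (N * suc w)
    insert-between i<k k<j h = insert-size h λ v → fits-size-between c≤1 k≢ i<j′ v i<k k<j

  -- Writing the half-length as `m + r` makes `r`, and hence `w`, the same at every step. Letter 0
  -- is deleted while it precedes `i`; once `i` is 0, letter 1 is deleted while it precedes `j`;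
  -- then letter 2, until only the linked pair is left.
  valid-size : ∀ m (lab : Fin m → ℕ) → Increasing lab → ∀ i j → toℕ i < toℕ j →
    HasSize (Valid c (m + r) lab i j ∘ lookup) (w ^ (m + toℕ i ∸ toℕ j) * suc w ^ (toℕ j ∸ toℕ i ∸ 1))
  valid-size (suc m) lab inc (suc i) (suc j) (s≤s i<j) =
    subst (HasSize _) exponent
      (insert-outside inc zero i<j (λ (i<0 , _) → ℕP.<-asym i<0 (inc (s≤s z≤n)))
        (valid-size m (lab ∘ suc) (inc ∘ s≤s) i j i<j))
    where
    a = m + toℕ i ∸ toℕ j
    b = toℕ j ∸ toℕ i ∸ 1
    -- Subtraction is truncated, so this bound is what allows a successor to be moved into the
    -- exponent.
    j≤m+i : toℕ j ≤ m + toℕ i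
    j≤m+i = ℕP.≤-trans (ℕP.<⇒≤ (FinP.toℕ<n j)) (ℕP.m≤m+n m (toℕ i))
    exponent : w ^ a * suc w ^ b * w ≡ w ^ (m + suc (toℕ i) ∸ toℕ j) * suc w ^ b
    exponent = begin
      w ^ a * suc w ^ b * w                          ≡⟨ ℕP.*-comm (w ^ a * suc w ^ b) w ⟩
      w * (w ^ a * suc w ^ b)                        ≡⟨ ℕP.*-assoc w (w ^ a) (suc w ^ b) ⟨
      w ^ suc a * suc w ^ b                          ≡⟨ cong (λ e → w ^ e * suc w ^ b) (ℕP.+-∸-assoc 1 j≤m+i) ⟨
      w ^ (suc (m + toℕ i) ∸ toℕ j) * suc w ^ b      ≡⟨ cong (λ e → w ^ (e ∸ toℕ j) * suc w ^ b) (ℕP.+-suc m (toℕ i)) ⟨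
      w ^ (m + suc (toℕ i) ∸ toℕ j) * suc w ^ b      ∎
      where open ≡-Reasoning
  valid-size (suc (suc m)) lab inc zero (suc (suc j)) _ =
    subst (HasSize _)
      (trans (ℕP.*-assoc (w ^ a) (suc w ^ toℕ j) (suc w)) (cong (w ^ a *_) (ℕP.*-comm (suc w ^ toℕ j) (suc w))))
      (insert-between inc (suc zero) {zero} {suc j} (s≤s z≤n) (inc (s≤s z≤n)) (inc (s≤s (s≤s z≤n)))
        (valid-size (suc m) (lab ∘ punchIn (suc zero)) (inc ∘ punchIn-mono-< (suc zero)) zero (suc j) (s≤s z≤n)))
    where a = m + 0 ∸ toℕ j
  valid-size (suc (suc zero)) lab inc zero (suc zero) _ =
    subst (HasSize _) (sym (trans (ℕP.*-identityʳ (w * 1)) (ℕP.*-identityʳ w))) linked-pair-size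
  valid-size (suc (suc (suc m))) lab inc zero (suc zero) _ =
    subst (HasSize _) exponent
      (insert-outside inc (suc (suc zero)) {zero} {suc zero} (s≤s z≤n) (λ (_ , 2<1) → ℕP.<-asym 2<1 (inc (s≤s (s≤s z≤n))))
        (valid-size (suc (suc m)) (lab ∘ punchIn (suc (suc zero))) (inc ∘ punchIn-mono-< (suc (suc zero)))
          zero (suc zero) (s≤s z≤n)))
    where
    exponent : w ^ suc (m + 0) * 1 * w ≡ w ^ suc (suc (m + 0)) * 1
    exponent = trans (ℕP.*-comm _ w) (sym (ℕP.*-assoc w (w ^ suc (m + 0)) 1))

-- Points as configurations

tight-≤ : ∀ {x y n} → x ≤ n → y ≤ n → n + n ≤ x + y → x ≡ y
tight-≤ {x} {y} {n} x≤n y≤n 2n≤ = trans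
  (ℕP.≤-antisym x≤n (ℕP.+-cancelʳ-≤ n _ _ (ℕP.≤-trans 2n≤ (ℕP.+-monoʳ-≤ x y≤n))))
  (ℕP.≤-antisym (ℕP.+-cancelˡ-≤ n _ _ (ℕP.≤-trans 2n≤ (ℕP.+-monoˡ-≤ y x≤n))) y≤n)

tight-≥ : ∀ {x y n} → n ≤ x → n ≤ y → x + y ≤ n + n → x ≡ y
tight-≥ {x} {y} {n} n≤x n≤y ≤2n = trans
  (ℕP.≤-antisym (ℕP.+-cancelʳ-≤ n _ _ (ℕP.≤-trans (ℕP.+-monoʳ-≤ x n≤y) ≤2n)) n≤x)
  (ℕP.≤-antisym n≤y (ℕP.+-cancelˡ-≤ n _ _ (ℕP.≤-trans (ℕP.+-monoˡ-≤ y n≤x) ≤2n)))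

toCell : (n q x : ℕ) → Cell
toCell n q x with x ≤? n
... | yes _ = lower , x
... | no  _ = upper , q ∸ x

-- The graph of `toCell`, with `x + p ≡ q` in place of a truncated subtraction.
data InHalf (n q x : ℕ) : Cell → Set where
  low  : x ≤ n → InHalf n q x (lower , x)
  high : ∀ {p} → n < x → x + p ≡ q → InHalf n q x (upper , p)

toCell-view : ∀ n {q x} → x < q → InHalf n q x (toCell n q x)
toCell-view n {q} {x} x<q with x ≤? n
... | yes x≤n = low x≤n
... | no  x≰n = high (ℕP.≰⇒> x≰n) (ℕP.m+[n∸m]≡n (ℕP.<⇒≤ x<q))

InHalf-functional : ∀ {n q x u v} → InHalf n q x u → InHalf n q x v → u ≡ v
InHalf-functional (low _)     (low _)      = refl
InHalf-functional (low x≤n)   (high n<x _) = contradiction x≤n (ℕP.<⇒≱ n<x)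
InHalf-functional (high n<x _) (low x≤n)   = contradiction x≤n (ℕP.<⇒≱ n<x)
InHalf-functional {x = x} (high _ e) (high _ e′) = cong (upper ,_) (ℕP.+-cancelˡ-≡ x _ _ (trans e (sym e′)))

InHalf-injective : ∀ {n q x y u} → InHalf n q x u → InHalf n q y u → x ≡ y
InHalf-injective (low _) (low _) = refl
InHalf-injective (high {p} _ e) (high _ e′) = ℕP.+-cancelʳ-≡ p _ _ (trans e (sym e′))

-- For representatives from 2 to `q - 1`, a sum congruent to 0 or 1 modulo `q` can only be `q` or
-- `q + 1`.
SumsAvoid : (q x y : ℕ) → Set
SumsAvoid q x y = x + y ≢ q × x + y ≢ suc q

module Halves {c n : ℕ} (c≤1 : c ≤ 1) where

  private variable
    x y : ℕ

  q : ℕ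
  q = n + n + c

  2n≤q : n + n ≤ q
  2n≤q = ℕP.m≤m+n (n + n) c

  q≤1+2n : q ≤ suc (n + n)
  q≤1+2n = ℕP.≤-trans (ℕP.+-monoʳ-≤ (n + n) c≤1) (ℕP.≤-reflexive (ℕP.+-comm (n + n) 1))

  -- Distinct representatives in one half have a sum below `2n` or above `2n + 2`, whereas `q` and
  -- `q + 1` lie between these bounds. So sum hyperplanes concern different halves only.
  sums-low : x ≤ n → y ≤ n → x ≢ y → SumsAvoid q x y
  sums-low x≤n y≤n x≢y =
    (λ e → x≢y (tight-≤ x≤n y≤n (ℕP.≤-trans 2n≤q (ℕP.≤-reflexive (sym e))))) ,
    (λ e → x≢y (tight-≤ x≤n y≤n (ℕP.≤-trans (ℕP.m≤n⇒m≤1+n 2n≤q) (ℕP.≤-reflexive (sym e)))))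

  sums-high : n < x → n < y → x ≢ y → SumsAvoid q x y
  sums-high n<x n<y x≢y =
    (λ e → x≢y (tight-≥ n<x n<y (ℕP.≤-trans (ℕP.≤-reflexive e) (ℕP.<⇒≤ 1+q≤)))) ,
    (λ e → x≢y (tight-≥ n<x n<y (ℕP.≤-trans (ℕP.≤-reflexive e) 1+q≤)))
    where
    1+q≤ : suc q ≤ suc n + suc n
    1+q≤ = ℕP.≤-trans (s≤s q≤1+2n) (ℕP.≤-reflexive (cong suc (sym (ℕP.+-suc n n))))

  -- Consecutive residues in different halves straddle the middle, so they sum to q or q + 1.
  consecutive-across : n < x → y ≤ n → x ≡ suc y → ¬ SumsAvoid q x y
  consecutive-across {y = y} (s≤s n≤y) y≤n refl (≢q , ≢1+q) with ℕP.≤-antisym n≤y y≤n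
  ... | refl with ℕP.m≤n⇒m<n∨m≡n c≤1
  ...   | inj₁ c<1 = ≢1+q (cong suc (sym (trans (cong (λ z → n + n + z) (ℕP.n<1⇒n≡0 c<1)) (ℕP.+-identityʳ (n + n)))))
  ...   | inj₂ c≡1 = ≢q (sym (trans (cong (λ z → n + n + z) c≡1) (ℕP.+-comm (n + n) 1)))

  sum-cancelˡ : ∀ {p} → x + p ≡ q → x + y ≡ q → y ≡ p
  sum-cancelˡ {x} e e′ = ℕP.+-cancelˡ-≡ x _ _ (trans e′ (sym e))

  sum-cancelˡ′ : ∀ {p} → x + p ≡ q → x + y ≡ suc q → y ≡ suc p
  sum-cancelˡ′ {x} {p = p} e e′ = ℕP.+-cancelˡ-≡ x _ _ (trans e′ (sym (trans (ℕP.+-suc x p) (cong suc e))))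

  sums⇒ : ∀ {p} → x + p ≡ q → SumsAvoid q x y → y ≢ p × y ≢ suc p
  sums⇒ {x} {p = p} e (≢q , ≢1+q) = (λ { refl → ≢q e }) , (λ { refl → ≢1+q (trans (ℕP.+-suc x p) (cong suc e)) })

  sums⇐ : ∀ {p} → x + p ≡ q → y ≢ p → y ≢ suc p → SumsAvoid q x y
  sums⇐ e ≢p ≢1+p = ≢p ∘ sum-cancelˡ e , ≢1+p ∘ sum-cancelˡ′ e

  sums-sym : SumsAvoid q x y → SumsAvoid q y x
  sums-sym {x} {y} = subst (λ z → z ≢ q × z ≢ suc q) (ℕP.+-comm x y)

  complement-suc : ∀ {p r} → x + p ≡ q → y + r ≡ q → r ≡ suc p → x ≡ suc y
  complement-suc {x} {y} {p} e e′ refl = ℕP.+-cancelʳ-≡ p _ _ (trans e (trans (sym e′) (ℕP.+-suc y p)))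

  complement-suc⁻ : ∀ {p r} → x + p ≡ q → y + r ≡ q → x ≡ suc y → r ≡ suc p
  complement-suc⁻ {x} {y} {p} e e′ refl = ℕP.+-cancelˡ-≡ y _ _ (trans e′ (trans (sym e) (sym (ℕP.+-suc y p))))

  -- Across the halves, sum `q` means a shared position, and sum `q + 1` means an upper letter
  -- directly before a lower one. Within a half the differences decide.
  Compatible⇐ : ∀ {a b u v} → a < b → InHalf n q x u → InHalf n q y v →
    SumsAvoid q x y → x ≢ y → x ≢ suc y → Compatible a u b v
  Compatible⇐ a<b (low _) (low _) _ x≢y x≢1+y = x≢y , (λ _ → lower a<b) , λ e → contradiction e x≢1+y
  Compatible⇐ {x = x} {y} a<b (low _) (high _ e) sums _ _ =
    let ≢p , ≢1+p = sums⇒ e (sums-sym {x} {y} sums) in ≢p , (λ _ → across) , λ e′ → contradiction e′ ≢1+p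
  Compatible⇐ a<b (high _ e) (low _) sums _ _ =
    let ≢p , ≢1+p = sums⇒ e sums in ≢p ∘ sym , (λ e′ → contradiction e′ ≢1+p) , λ _ → across
  Compatible⇐ a<b (high {p} _ e) (high _ e′) _ x≢y x≢1+y =
    (λ { refl → x≢y (ℕP.+-cancelʳ-≡ p _ _ (trans e (sym e′))) }) ,
    (λ r≡ → contradiction (complement-suc e e′ r≡) x≢1+y) , (λ _ → upper a<b)

  Compatible⇒ : ∀ {a b u v} → a < b → InHalf n q x u → InHalf n q y v → Compatible a u b v →
    SumsAvoid q x y × x ≢ y × x ≢ suc y
  Compatible⇒ a<b (low x≤n) (low y≤n) (x≢y , _ , desc) =
    sums-low x≤n y≤n x≢y , x≢y , λ e → case-lower (desc e)
    where
    case-lower : ¬ (lower , _) ≺ (lower , _)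
    case-lower (lower b<a) = ℕP.<-asym a<b b<a
  Compatible⇒ {x = x} {y} a<b (low x≤n) (high n<y e) (p≢r , _ , desc) =
    sums-sym {y} {x} (sums⇐ e p≢r λ e′ → case-across (desc e′)) ,
    ℕP.<⇒≢ (ℕP.≤-<-trans x≤n n<y) , ℕP.<⇒≢ (ℕP.≤-<-trans x≤n (ℕP.m≤n⇒m≤1+n n<y))
    where
    case-across : ¬ (upper , _) ≺ (lower , _)
    case-across ()
  Compatible⇒ {x = x} {y} a<b (high n<x e) (low y≤n) (p≢r , asc , _) =
    sums , ℕP.<⇒≢ (ℕP.≤-<-trans y≤n n<x) ∘ sym , λ e′ → consecutive-across n<x y≤n e′ sums
    where
    case-across : ¬ (upper , _) ≺ (lower , _)
    case-across ()
    sums : SumsAvoid q x y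
    sums = sums⇐ e (p≢r ∘ sym) (λ e′ → case-across (asc e′))
  Compatible⇒ {x = x} {y} a<b (high n<x e) (high n<y e′) (p≢r , asc , _) =
    sums-high n<x n<y x≢y , x≢y , λ x≡ → case-upper (asc (complement-suc⁻ e e′ x≡))
    where
    case-upper : ¬ (upper , _) ≺ (upper , _)
    case-upper (upper b<a) = ℕP.<-asym a<b b<a
    x≢y : x ≢ y
    x≢y refl = p≢r (sym (sum-cancelˡ e e′))

  Linked⇐ : ∀ {u v} → InHalf n q x u → InHalf n q y v → SumsAvoid q x y → x ≡ suc y → Linked u v
  Linked⇐ (low _) (low _) _ e = e
  Linked⇐ (low x≤n) (high n<y _) _ e = contradiction e (ℕP.<⇒≢ (ℕP.≤-<-trans x≤n (ℕP.m≤n⇒m≤1+n n<y)))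
  Linked⇐ (high n<x _) (low y≤n) sums e = consecutive-across n<x y≤n e sums
  Linked⇐ (high _ e) (high _ e′) _ x≡ = complement-suc⁻ e e′ x≡

  Linked⇒ : ∀ {u v} → InHalf n q x u → InHalf n q y v → Linked u v → SumsAvoid q x y × x ≡ suc y
  Linked⇒ (low x≤n) (low y≤n) refl = sums-low x≤n y≤n ℕP.1+n≢n , refl
  Linked⇒ {x = x} {y} (high n<x e) (high n<y e′) r≡ with refl ← complement-suc {x} {y} e e′ r≡ =
    sums-high n<x n<y ℕP.1+n≢n , refl

  InRange⇐ : ∀ {u} → x < q → 2 ≤ x → InHalf n q x u → InRange c n u
  InRange⇐ x<q 2≤x (low x≤n) = 2≤x , x≤n
  InRange⇐ {x} x<q 2≤x (high {p} n<x e) =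
    ℕP.+-cancelˡ-< x 0 p (subst₂ _<_ (sym (ℕP.+-identityʳ x)) (sym e) x<q) ,
    ℕP.+-cancelˡ-< n p (n + c) (subst (n + p <_) (trans e (ℕP.+-assoc n n c)) (ℕP.+-monoˡ-< p n<x))

  -- An upper representative exceeds `n`, so `1 ≤ n` keeps it away from 0 and 1.
  InRange⇒ : ∀ {u} → 1 ≤ n → InHalf n q x u → InRange c n u → 2 ≤ x
  InRange⇒ 1≤n (low _)      (2≤x , _) = 2≤x
  InRange⇒ 1≤n (high n<x _) _         = ℕP.≤-<-trans 1≤n n<x

  toCell-onto : 1 ≤ n → ∀ u → InRange c n u → ∃ λ x → x < q × toCell n q x ≡ u
  toCell-onto 1≤n (lower , p) (_ , p≤n) = p , p<q , InHalf-functional (toCell-view n p<q) (low p≤n)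
    where
    p<q : p < q
    p<q = ℕP.≤-trans (s≤s p≤n) (ℕP.≤-trans (ℕP.+-monoˡ-≤ n 1≤n) 2n≤q)
  toCell-onto 1≤n (upper , p) (1≤p , p<n+c) =
    q ∸ p , q∸p<q , InHalf-functional (toCell-view n q∸p<q) (high n<q∸p (ℕP.m∸n+n≡m p≤q))
    where
    n+p<q : n + p < q
    n+p<q = subst (n + p <_) (sym (ℕP.+-assoc n n c)) (ℕP.+-monoʳ-< n p<n+c)
    p≤q : p ≤ q
    p≤q = ℕP.≤-trans (ℕP.m≤n+m p n) (ℕP.<⇒≤ n+p<q)
    n<q∸p : n < q ∸ p
    n<q∸p = ℕP.+-cancelʳ-< p n (q ∸ p) (subst (n + p <_) (sym (ℕP.m∸n+n≡m p≤q)) n+p<q)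
    q∸p<q : q ∸ p < q
    q∸p<q = ℕP.∸-monoʳ-< 1≤p p≤q

-- Points of the hyperplane x_i = x_j + 1 that lie on no other hyperplane, by representatives x s < q.
record Avoiding (q : ℕ) (i j : Fin m) (x : Fin m → ℕ) : Set where
  field
    above-1  : ∀ s → 2 ≤ x s
    sums     : ∀ {s t} → toℕ s < toℕ t → SumsAvoid q (x s) (x t)
    distinct : ∀ {s t} → toℕ s < toℕ t → x s ≢ x t
    no-step  : ∀ {s t} → toℕ s < toℕ t → ¬ (s ≡ i × t ≡ j) → x s ≢ suc (x t)
    step     : x i ≡ suc (x j)


module _ {c n : ℕ} (c≤1 : c ≤ 1) (1≤n : 1 ≤ n) {i j : Fin m} (i<j : toℕ i < toℕ j) where
  open Halves {c} {n} c≤1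

  module _ (x : Fin m → ℕ) (x<q : ∀ s → x s < q) where

    private
      view : ∀ s → InHalf n q (x s) (toCell n q (x s))
      view s = toCell-view n (x<q s)

    Avoiding⇒Valid : Avoiding q i j x → Valid c n toℕ i j (toCell n q ∘ x)
    Avoiding⇒Valid a = record
      { inRange    = λ s → InRange⇐ (x<q s) (above-1 a s) (view s)
      ; compatible = compat
      ; linked     = Linked⇐ (view i) (view j) (sums a i<j) (step a)
      }
      where
      open Avoiding
      compat : ∀ {s t} → Unexceptional i j s t → Compatible (toℕ s) (toCell n q (x s)) (toℕ t) (toCell n q (x t))
      compat {s} {t} (s≢t , ij , ji) with FinP.<-cmp s t
      ... | tri< s<t _ _ = Compatible⇐ s<t (view s) (view t) (sums a s<t) (distinct a s<t) (no-step a s<t ij)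
      ... | tri≈ _ s≡t _ = contradiction s≡t s≢t
      ... | tri> _ _ t<s = Compatible-sym (Compatible⇐ t<s (view t) (view s) (sums a t<s) (distinct a t<s)
        (no-step a t<s λ (t≡i , s≡j) → ji (s≡j , t≡i)))

    Valid⇒Avoiding : Valid c n toℕ i j (toCell n q ∘ x) → Avoiding q i j x
    Valid⇒Avoiding v = record
      { above-1  = λ s → InRange⇒ 1≤n (view s) (inRange v s)
      ; sums     = λ s<t → proj₁ (apart s<t)
      ; distinct = λ s<t → proj₂ (apart s<t)
      ; no-step  = λ s<t ij → proj₂ (proj₂ (generic s<t ij))
      ; step     = proj₂ pair
      }
      where
      pair : SumsAvoid q (x i) (x j) × x i ≡ suc (x j)
      pair = Linked⇒ (view i) (view j) (linked v)
      generic : ∀ {s t} → toℕ s < toℕ t → ¬ (s ≡ i × t ≡ j) → SumsAvoid q (x s) (x t) × x s ≢ x t × x s ≢ suc (x t)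
      generic {s} {t} s<t ij = Compatible⇒ s<t (view s) (view t) (compatible v
        ((λ { refl → ℕP.<-irrefl refl s<t }) , ij , λ { (refl , refl) → ℕP.<-asym s<t i<j }))
      apart : ∀ {s t} → toℕ s < toℕ t → SumsAvoid q (x s) (x t) × x s ≢ x t
      apart {s} {t} s<t with (s FinP.≟ i) ×-dec (t FinP.≟ j)
      ... | yes (refl , refl) = proj₁ pair , λ e → ℕP.1+n≢n (trans (sym (proj₂ pair)) e)
      ... | no ij = map₂ proj₁ (generic s<t ij)

  values : Vec (Fin q) m → Fin m → ℕ
  values x s = toℕ (lookup x s)

  cells : Vec (Fin q) m → Vec Cell m
  cells = map (toCell n q ∘ toℕ)

  cells-injective : ∀ {x y} → cells x ≡ cells y → x ≡ y
  cells-injective {x} {y} eq = lookup-ext λ s → FinP.toℕ-injective (InHalf-injective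
    (toCell-view n (FinP.toℕ<n (lookup x s)))
    (subst (InHalf n q _) (trans (sym (lookup-map s _ y)) (trans (cong (λ z → lookup z s) (sym eq)) (lookup-map s _ x)))
      (toCell-view n (FinP.toℕ<n (lookup y s)))))

  Avoiding-size : ∀ {N} → HasSize (Avoiding q i j ∘ values) N → HasSize (Valid c n toℕ i j ∘ lookup) N
  Avoiding-size = HasSize-image cells cells-injective
    (λ {x} a → Valid-cong (λ s → sym (lookup-map s _ x)) (Avoiding⇒Valid (values x) (λ s → FinP.toℕ<n (lookup x s)) a))
    onto
    where
    onto : ∀ {y} → Valid c n toℕ i j (lookup y) → ∃ λ x → (Avoiding q i j ∘ values) x × cells x ≡ y
    onto {y} v = xs , Valid⇒Avoiding (values xs) (λ s → FinP.toℕ<n (lookup xs s)) (Valid-cong (sym ∘ same) v) ,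
        lookup-ext (λ s → trans (lookup-map s _ xs) (same s))
      where
      preimage : ∀ s → ∃ λ x → x < q × toCell n q x ≡ lookup y s
      preimage s = toCell-onto 1≤n (lookup y s) (inRange v s)
      xs : Vec (Fin q) m
      xs = tabulate λ s → fromℕ< (proj₁ (proj₂ (preimage s)))
      same : ∀ s → toCell n q (toℕ (lookup xs s)) ≡ lookup y s
      same s = trans (cong (toCell n q) (trans (cong toℕ (lookup∘tabulate _ s)) (FinP.toℕ-fromℕ< _)))
        (proj₂ (proj₂ (preimage s)))

-- The hyperplanes of the Shi arrangement

private variable
  q : ℕ

-- Divisibility by `q` as equality of representatives

∣⇒≡0 : ∀ {d} → d < q → q ∣ d → d ≡ 0
∣⇒≡0 {d = zero}  _   _   = refl
∣⇒≡0 {d = suc d} d<q q∣d = contradiction q∣d (>⇒∤ d<q)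

∣⇒≡q : ∀ {d} → 0 < d → d < q + q → q ∣ d → d ≡ q
∣⇒≡q 0<d d<2q (divides zero refl) = contradiction 0<d (ℕP.<-irrefl refl)
∣⇒≡q {q} 0<d d<2q (divides (suc zero) d≡) = trans d≡ (ℕP.+-identityʳ q)
∣⇒≡q {q} {d} 0<d d<2q (divides (suc (suc k)) d≡) = contradiction d<2q (ℕP.≤⇒≯ (begin
  q + q             ≤⟨ ℕP.+-monoʳ-≤ q (ℕP.m≤m+n q (k * q)) ⟩
  q + (q + k * q)   ≡⟨ d≡ ⟨
  d                 ∎))
  where open ℕP.≤-Reasoning

∣A-B∣ : ∀ {A B} → B ≤ A → ∣ + A ℤ.- + B ∣ ≡ A ∸ B
∣A-B∣ {A} {B} B≤A = cong ∣_∣ (trans (ℤP.m-n≡m⊖n A B) (ℤP.⊖-≥ B≤A))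

∣A-B∣′ : ∀ {A B} → A ≤ B → ∣ + A ℤ.- + B ∣ ≡ B ∸ A
∣A-B∣′ {A} {B} A≤B = trans (cong ∣_∣ (ℤP.m-n≡m⊖n A B)) (ℤP.∣⊖∣-≤ A≤B)

≡⇒∣ : ∀ {A B} → A ≡ B → q ∣ ∣ + A ℤ.- + B ∣
≡⇒∣ {q} {A} refl = subst (q ∣_) (sym (trans (∣A-B∣ {A} ℕP.≤-refl) (ℕP.n∸n≡0 A))) (q ∣0)

≡+q⇒∣ : ∀ {A B} → A ≡ B + q → q ∣ ∣ + A ℤ.- + B ∣
≡+q⇒∣ {q} {B = B} refl = subst (q ∣_) (sym (trans (∣A-B∣ (ℕP.m≤m+n B q)) (ℕP.m+n∸m≡n B q))) ∣-refl

∣⇒≡ : ∀ {A B} → A < B + q → B < A + q → q ∣ ∣ + A ℤ.- + B ∣ → A ≡ B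
∣⇒≡ {q} {A} {B} A< B< q∣ with ℕP.≤-total B A
... | inj₁ B≤A = ℕP.≤-antisym (ℕP.m∸n≡0⇒m≤n (∣⇒≡0 (ℕP.m<n+o⇒m∸n<o A B {{≢0 A<}} A<) (subst (q ∣_) (∣A-B∣ B≤A) q∣))) B≤A
  where
  ≢0 = λ lt → >-nonZero (ℕP.+-cancelˡ-< B 0 q (subst (_< B + q) (sym (ℕP.+-identityʳ B)) (ℕP.≤-<-trans B≤A lt)))
... | inj₂ A≤B = ℕP.≤-antisym A≤B (ℕP.m∸n≡0⇒m≤n (∣⇒≡0 (ℕP.m<n+o⇒m∸n<o B A {{≢0 B<}} B<) (subst (q ∣_) (∣A-B∣′ A≤B) q∣)))
  where
  ≢0 = λ lt → >-nonZero (ℕP.+-cancelˡ-< A 0 q (subst (_< A + q) (sym (ℕP.+-identityʳ A)) (ℕP.≤-<-trans A≤B lt)))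

∣⇒≡+q : ∀ {A B} → B < A → A < q + q → q ∣ ∣ + A ℤ.- + B ∣ → A ≡ B + q
∣⇒≡+q {q} {A} {B} B<A A<2q q∣ = trans (sym (ℕP.m+[n∸m]≡n (ℕP.<⇒≤ B<A))) (cong (λ d → B + d)
  (∣⇒≡q (ℕP.m<n⇒0<n∸m B<A) (ℕP.≤-<-trans (ℕP.m∸n≤m A B) A<2q) (subst (q ∣_) (∣A-B∣ (ℕP.<⇒≤ B<A)) q∣)))

-- The entries of e are given by a where-bound function that cannot be named outside Defs;
-- it is recovered here by unification.
e-entries : (s : Fin m) → ∃ λ f → e s ≡ tabulate f
e-entries s = _ , refl

lookup-e : (s k : Fin m) → (k ≡ s × lookup (e s) k ≡ + 1) ⊎ (k ≢ s × lookup (e s) k ≡ + 0)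
lookup-e s k with entry s k
  where
  entry : (s k : Fin m) → (k ≡ s × proj₁ (e-entries s) k ≡ + 1) ⊎ (k ≢ s × proj₁ (e-entries s) k ≡ + 0)
  entry s k with k FinP.≟ s
  ... | yes k≡s = inj₁ (k≡s , refl)
  ... | no  k≢s = inj₂ (k≢s , refl)
... | inj₁ (k≡s , eq) = inj₁ (k≡s , trans (lookup∘tabulate _ k) eq)
... | inj₂ (k≢s , eq) = inj₂ (k≢s , trans (lookup∘tabulate _ k) eq)

lookup-e-≡ : (s : Fin m) → lookup (e s) s ≡ + 1
lookup-e-≡ s with lookup-e s s
... | inj₁ (_ , eq)  = eq
... | inj₂ (s≢s , _) = contradiction refl s≢s

lookup-e-≢ : {s k : Fin m} → k ≢ s → lookup (e s) k ≡ + 0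
lookup-e-≢ {s = s} {k} k≢s with lookup-e s k
... | inj₁ (k≡s , _) = contradiction k≡s k≢s
... | inj₂ (_ , eq)  = eq

-- Values of the linear forms

dot : Vec ℤ m → Vec (Fin q) m → ℤ
dot a x = foldr _ ℤ._+_ (+ 0) (zipWith (λ aₖ xₖ → aₖ ℤ.* (+ toℕ xₖ)) a x)

dot-zero : (a : Vec ℤ m) (x : Vec (Fin q) m) → (∀ k → lookup a k ≡ + 0) → dot a x ≡ + 0
dot-zero []      []      _    = refl
dot-zero (_ ∷ a) (_ ∷ x) zero′ rewrite zero′ zero = trans (ℤP.+-identityˡ _) (dot-zero a x (zero′ ∘ suc))

dot-unit : (a : Vec ℤ m) (x : Vec (Fin q) m) (s : Fin m) → lookup a s ≡ + 1 → (∀ {k} → k ≢ s → lookup a k ≡ + 0) →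
  dot a x ≡ + toℕ (lookup x s)
dot-unit (_ ∷ a) (y ∷ x) zero    refl others =
  trans (cong₂ ℤ._+_ (ℤP.*-identityˡ (+ toℕ y)) (dot-zero a x λ k → others {suc k} λ ())) (ℤP.+-identityʳ (+ toℕ y))
dot-unit (_ ∷ a) (y ∷ x) (suc s) one others rewrite others {zero} (λ ()) =
  trans (ℤP.+-identityˡ _) (dot-unit a x s one λ k≢s → others (k≢s ∘ FinP.suc-injective))

dot-e : (s : Fin m) (x : Vec (Fin q) m) → dot (e s) x ≡ + toℕ (lookup x s)
dot-e s x = dot-unit (e s) x s (lookup-e-≡ s) lookup-e-≢

dot-⊕ : (a b : Vec ℤ m) (x : Vec (Fin q) m) → dot (a ⊕ b) x ≡ dot a x ℤ.+ dot b x
dot-⊕ []      []      []      = refl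
dot-⊕ (α ∷ a) (β ∷ b) (y ∷ x) =
  trans (cong (λ z → (α ℤ.+ β) ℤ.* (+ toℕ y) ℤ.+ z) (dot-⊕ a b x)) (rearrange α β (+ toℕ y) (dot a x) (dot b x))
  where
  rearrange : ∀ α β y u v → (α ℤ.+ β) ℤ.* y ℤ.+ (u ℤ.+ v) ≡ (α ℤ.* y ℤ.+ u) ℤ.+ (β ℤ.* y ℤ.+ v)
  rearrange = solve-∀

dot-⊖ : (a b : Vec ℤ m) (x : Vec (Fin q) m) → dot (a ⊖ b) x ≡ dot a x ℤ.- dot b x
dot-⊖ []      []      []      = refl
dot-⊖ (α ∷ a) (β ∷ b) (y ∷ x) =
  trans (cong (λ z → (α ℤ.- β) ℤ.* (+ toℕ y) ℤ.+ z) (dot-⊖ a b x)) (rearrange α β (+ toℕ y) (dot a x) (dot b x))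
  where
  rearrange : ∀ α β y u v → (α ℤ.- β) ℤ.* y ℤ.+ (u ℤ.- v) ≡ (α ℤ.* y ℤ.+ u) ℤ.- (β ℤ.* y ℤ.+ v)
  rearrange = solve-∀

-- Membership in the arrangement

data InShi {m : ℕ} : Hyperplane m → Set where
  coord₀ : ∀ s → InShi (e s , + 0)
  coord₁ : ∀ s → InShi (e s , + 1)
  sum₀   : ∀ {s t} → toℕ s < toℕ t → InShi (e s ⊕ e t , + 0)
  sum₁   : ∀ {s t} → toℕ s < toℕ t → InShi (e s ⊕ e t , + 1)
  diff₀  : ∀ {s t} → toℕ s < toℕ t → InShi (e s ⊖ e t , + 0)
  diff₁  : ∀ {s t} → toℕ s < toℕ t → InShi (e s ⊖ e t , + 1)

-- As above, for a where-bound function of ordPairs.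
keepPairs : (m : ℕ) → Σ (Fin m → Fin m → List (Fin m × Fin m)) λ keep →
  ordPairs m ≡ concatMap (λ s → concatMap (keep s) (allFin m)) (allFin m)
keepPairs m = _ , refl

keep : Fin m → Fin m → List (Fin m × Fin m)
keep = proj₁ (keepPairs _)

∈-keep⁺ : ∀ {s t : Fin m} → toℕ s < toℕ t → (s , t) ∈ keep s t
∈-keep⁺ {s = s} {t} s<t with toℕ s <? toℕ t
... | yes _  = here refl
... | no s≮t = contradiction s<t s≮t

∈-keep⁻ : ∀ {s t : Fin m} {st} → st ∈ keep s t → toℕ (proj₁ st) < toℕ (proj₂ st)
∈-keep⁻ {s = s} {t} st∈ with toℕ s <? toℕ t | st∈
... | yes s<t | here refl = s<t

∈-ordPairs⁺ : ∀ {s t : Fin m} → toℕ s < toℕ t → (s , t) ∈ ordPairs m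
∈-ordPairs⁺ {m} {s} {t} s<t = ∈-concatMap⁺ (λ s → concatMap (keep s) (allFin m))
  (lose (∈-allFin s) (∈-concatMap⁺ (keep s) (lose (∈-allFin t) (∈-keep⁺ s<t))))

∈-ordPairs⁻ : ∀ {st} → st ∈ ordPairs m → toℕ (proj₁ st) < toℕ (proj₂ st)
∈-ordPairs⁻ {m} st∈ =
  let s , _ , st∈₁ = find (∈-concatMap⁻ (λ s → concatMap (keep s) (allFin m)) {xs = allFin m} st∈)
      t , _ , st∈₂ = find (∈-concatMap⁻ (keep s) {xs = allFin m} st∈₁)
  in ∈-keep⁻ {s = s} {t} st∈₂

coordinateHyperplanes : Fin m → List (Hyperplane m)
coordinateHyperplanes s = (e s , + 0) ∷ (e s , + 1) ∷ []

pairHyperplanes : Fin m × Fin m → List (Hyperplane m)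
pairHyperplanes (s , t) =
  (e s ⊕ e t , + 0) ∷ (e s ⊕ e t , + 1) ∷ (e s ⊖ e t , + 0) ∷ (e s ⊖ e t , + 1) ∷ []

∈-shiB⁺ : ∀ {H} → InShi H → H ∈ shiB m
∈-shiB⁺ {m} = λ where
    (coord₀ s) → ∈-++⁺ˡ (coord s (here refl))
    (coord₁ s) → ∈-++⁺ˡ (coord s (there (here refl)))
    (sum₀ s<t) → pair s<t (here refl)
    (sum₁ s<t) → pair s<t (there (here refl))
    (diff₀ s<t) → pair s<t (there (there (here refl)))
    (diff₁ s<t) → pair s<t (there (there (there (here refl))))
  where
  coord : ∀ {H} s → H ∈ coordinateHyperplanes s → H ∈ concatMap coordinateHyperplanes (allFin m)
  coord s H∈ = ∈-concatMap⁺ coordinateHyperplanes (lose (∈-allFin s) H∈)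
  pair : ∀ {H s t} → toℕ s < toℕ t → H ∈ pairHyperplanes (s , t) → H ∈ shiB m
  pair s<t H∈ = ∈-++⁺ʳ (concatMap coordinateHyperplanes (allFin m))
    (∈-concatMap⁺ pairHyperplanes (lose (∈-ordPairs⁺ s<t) H∈))

∈-shiB⁻ : ∀ {H} → H ∈ shiB m → InShi H
∈-shiB⁻ {m} H∈ with ∈-++⁻ (concatMap coordinateHyperplanes (allFin m)) H∈
... | inj₁ H∈₁ with find (∈-concatMap⁻ coordinateHyperplanes {xs = allFin m} H∈₁)
...   | s , _ , here refl         = coord₀ s
...   | s , _ , there (here refl) = coord₁ s
∈-shiB⁻ {m} H∈ | inj₂ H∈₂ with find (∈-concatMap⁻ pairHyperplanes {xs = ordPairs m} H∈₂)
...   | _ , st∈ , here refl                         = sum₀ (∈-ordPairs⁻ st∈)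
...   | _ , st∈ , there (here refl)                 = sum₁ (∈-ordPairs⁻ st∈)
...   | _ , st∈ , there (there (here refl))         = diff₀ (∈-ordPairs⁻ st∈)
...   | _ , st∈ , there (there (there (here refl))) = diff₁ (∈-ordPairs⁻ st∈)

-- Telling `x_i - x_j = 1` from the other hyperplanes

e-entry : ∀ (s k : Fin m) → ∃ λ (n : ℕ) → lookup (e s) k ≡ + n
e-entry s k = [ (λ (_ , eq) → 1 , eq) , (λ (_ , eq) → 0 , eq) ]′ (lookup-e s k)

module _ {i j : Fin m} (i<j : toℕ i < toℕ j) where

  private
    i≢j : i ≢ j
    i≢j refl = ℕP.<-irrefl refl i<j

  lookup-diff-j : lookup (e i ⊖ e j) j ≡ -[1+ 0 ]
  lookup-diff-j = trans (lookup-zipWith ℤ._-_ j (e i) (e j)) (cong₂ ℤ._-_ (lookup-e-≢ (i≢j ∘ sym)) (lookup-e-≡ j))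

  lookup-diff-i : lookup (e i ⊖ e j) i ≡ + 1
  lookup-diff-i = trans (lookup-zipWith ℤ._-_ i (e i) (e j)) (cong₂ ℤ._-_ (lookup-e-≡ i) (lookup-e-≢ i≢j))

  -- The coefficient -1 at `j` gives it away: coordinate and sum hyperplanes have natural
  -- coefficients.
  e≢diff : ∀ {s} → e s ≢ e i ⊖ e j
  e≢diff {s} eq with () ← trans (sym (proj₂ (e-entry s j))) (trans (cong (λ a → lookup a j) eq) lookup-diff-j)

  sum≢diff : ∀ {s t} → e s ⊕ e t ≢ e i ⊖ e j
  sum≢diff {s} {t} eq
    with () ← trans (sym (trans (lookup-zipWith ℤ._+_ j (e s) (e t))
                                (cong₂ ℤ._+_ (proj₂ (e-entry s j)) (proj₂ (e-entry t j)))))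
    (trans (cong (λ a → lookup a j) eq) lookup-diff-j)

  -- The entry -1 at `j` can only come from `e t`, and the entry 1 at `i` only from `e s`.
  diff-injective : ∀ {s t} → e s ⊖ e t ≡ e i ⊖ e j → s ≡ i × t ≡ j
  diff-injective {s} {t} eq = s≡i , t≡j
    where
    entry-j : lookup (e s) j ℤ.- lookup (e t) j ≡ -[1+ 0 ]
    entry-j = trans (sym (lookup-zipWith ℤ._-_ j (e s) (e t))) (trans (cong (λ a → lookup a j) eq) lookup-diff-j)
    entry-i : lookup (e s) i ℤ.- lookup (e t) i ≡ + 1
    entry-i = trans (sym (lookup-zipWith ℤ._-_ i (e s) (e t))) (trans (cong (λ a → lookup a i) eq) lookup-diff-i)
    t≡j : t ≡ j
    t≡j with lookup-e t j | e-entry s j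
    ... | inj₁ (j≡t , _)  | _ = sym j≡t
    ... | inj₂ (_ , eq₀) | n , eqₙ with () ← trans (sym (trans (cong₂ ℤ._-_ eqₙ eq₀) (ℤP.+-identityʳ (+ n)))) entry-j
    s≡i : s ≡ i
    s≡i with lookup-e s i | lookup-e t i
    ... | inj₁ (i≡s , _) | _ = sym i≡s
    ... | inj₂ (_ , eq₀) | inj₁ (_ , eq₁) with () ← trans (sym (cong₂ ℤ._-_ eq₀ eq₁)) entry-i
    s≡i | inj₂ (_ , eq₀) | inj₂ (_ , eq₁) with () ← trans (sym (cong₂ ℤ._-_ eq₀ eq₁)) entry-i

-- Enumeration of the points

concatMap-map : ∀ {A B C : Set} (f : A → B → C) xs ys →
  concatMap (λ x → List.map (f x) ys) xs ≡ cartesianProductWith f xs ys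
concatMap-map f []       ys = refl
concatMap-map f (x ∷ xs) ys = cong (List.map (f x) ys ++_) (concatMap-map f xs ys)

points-unique : ∀ q m → Unique (points q m)
points-unique q zero    = [] ∷ []
points-unique q (suc m) = subst Unique (sym (concatMap-map _∷_ (allFin q) (points q m)))
  (Unique.cartesianProductWith⁺ _∷_ (λ { refl → refl , refl }) (Unique.allFin⁺ q) (points-unique q m))

∈-points : (x : Vec (Fin q) m) → x ∈ points q m
∈-points []      = here refl
∈-points {q} {suc m} (y ∷ x) = subst (_ ∈_) (sym (concatMap-map _∷_ (allFin q) (points q m)))
  (∈-cartesianProductWith⁺ _∷_ (∈-allFin y) (∈-points x))

-- Points on exactly one hyperplane

module _ {i j : Fin m} (i<j : toℕ i < toℕ j) (x : Vec (Fin q) m) where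

  private
    X : Fin m → ℕ
    X s = toℕ (lookup x s)

    X<q : ∀ s → X s < q
    X<q s = FinP.toℕ<n (lookup x s)

    eval-e : ∀ s b → eval (e s , + b) x ≡ + X s ℤ.- + b
    eval-e s b = cong (ℤ._- + b) (dot-e s x)

    eval-sum : ∀ s t b → eval (e s ⊕ e t , + b) x ≡ + (X s + X t) ℤ.- + b
    eval-sum s t b = cong (ℤ._- + b) (trans (dot-⊕ (e s) (e t) x) (cong₂ ℤ._+_ (dot-e s x) (dot-e t x)))

    -- Moving the constant to the side of `X t` gives a difference of two natural numbers, the form
    -- in which divisibility was treated.
    eval-diff : ∀ s t b → eval (e s ⊖ e t , + b) x ≡ + X s ℤ.- + (X t + b)
    eval-diff s t b = trans (cong (ℤ._- + b) (trans (dot-⊖ (e s) (e t) x) (cong₂ ℤ._-_ (dot-e s x) (dot-e t x))))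
      (rearrange (+ X s) (+ X t) (+ b))
      where
      rearrange : ∀ u v b → u ℤ.- v ℤ.- b ≡ u ℤ.- (v ℤ.+ b)
      rearrange = solve-∀

    on : ∀ H {v} → eval H x ≡ v → q ∣ ∣ v ∣ → x ∈q H
    on H eq = subst (λ v → q ∣ ∣ v ∣) (sym eq)

    on⁻ : ∀ H {v} → eval H x ≡ v → x ∈q H → q ∣ ∣ v ∣
    on⁻ H eq = subst (λ v → q ∣ ∣ v ∣) eq

    2≤ : ∀ {n} → n ≢ 0 → n ≢ 1 → 2 ≤ n
    2≤ {zero}        n≢0 _   = contradiction refl n≢0
    2≤ {suc zero}    _   n≢1 = contradiction refl n≢1
    2≤ {suc (suc _)} _   _   = s≤s (s≤s z≤n)

    -- Modulo `q` the equation also has the wrapped solution `X i = 0`, `X j = q - 1`, which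
    -- `1 ≤ X i` rules out.
    consecutive : 1 ≤ X i → x ∈q hypDiff1 i j → X i ≡ suc (X j)
    consecutive 1≤Xi x∈ = trans (∣⇒≡ {B = X j + 1} (ℕP.<-≤-trans (X<q i) (ℕP.m≤n+m q (X j + 1)))
      (subst (_< X i + q) (ℕP.+-comm 1 (X j)) (ℕP.+-mono-≤-< 1≤Xi (X<q j)))
      (on⁻ (hypDiff1 i j) (eval-diff i j 1) x∈)) (ℕP.+-comm (X j) 1)

  avoids⇒Avoiding : All (λ H → ¬ x ∈q H) (shiBminus m (hypDiff1 i j)) → x ∈q hypDiff1 i j → Avoiding q i j X
  avoids⇒Avoiding all x∈ = record
    { above-1  = above-1
    ; sums     = λ {s} {t} s<t →
        (λ eq → avoid (sum₀ s<t) (sum≢diff i<j ∘ cong proj₁) (on (e s ⊕ e t , + 0) (eval-sum s t 0) (≡+q⇒∣ eq))) ,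
        (λ eq → avoid (sum₁ s<t) (sum≢diff i<j ∘ cong proj₁) (on (e s ⊕ e t , + 1) (eval-sum s t 1) (≡+q⇒∣ eq)))
    ; distinct = λ {s} {t} s<t eq → avoid (diff₀ s<t) (λ ())
        (on (e s ⊖ e t , + 0) (eval-diff s t 0) (≡⇒∣ (trans eq (sym (ℕP.+-identityʳ _)))))
    ; no-step  = λ {s} {t} s<t ij eq → avoid (diff₁ s<t) (ij ∘ diff-injective i<j ∘ cong proj₁)
        (on (e s ⊖ e t , + 1) (eval-diff s t 1) (≡⇒∣ (trans eq (ℕP.+-comm 1 (X t)))))
    ; step     = consecutive (ℕP.<⇒≤ (above-1 i)) x∈
    }
    where
    avoid : ∀ {H} → InShi H → H ≢ hypDiff1 i j → ¬ x ∈q H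
    avoid H∈ H≢ = All.lookup all (∈-filter⁺ _ (∈-shiB⁺ H∈) H≢)
    above-1 : ∀ s → 2 ≤ X s
    above-1 s = 2≤ (λ eq → avoid (coord₀ s) (e≢diff i<j ∘ cong proj₁) (on (e s , + 0) (eval-e s 0) (≡⇒∣ eq)))
      (λ eq → avoid (coord₁ s) (e≢diff i<j ∘ cong proj₁) (on (e s , + 1) (eval-e s 1) (≡⇒∣ eq)))

  module _ (a : Avoiding q i j X) where
    open Avoiding a

    Avoiding⇒∈ : x ∈q hypDiff1 i j
    Avoiding⇒∈ = on (hypDiff1 i j) (eval-diff i j 1) (≡⇒∣ (trans step (ℕP.+-comm 1 (X j))))

    Avoiding⇒∉ : ∀ {H} → InShi H → H ≢ hypDiff1 i j → ¬ x ∈q H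
    Avoiding⇒∉ (coord₀ s) _ x∈ = ℕP.<⇒≢ (ℕP.<-trans (s≤s z≤n) (above-1 s)) (sym
      (∣⇒≡ {B = 0} (X<q s) (ℕP.<-≤-trans (ℕP.≤-trans (s≤s z≤n) (above-1 s)) (ℕP.m≤m+n _ q))
        (on⁻ (e s , + 0) (eval-e s 0) x∈)))
    Avoiding⇒∉ (coord₁ s) _ x∈ = ℕP.<⇒≢ (above-1 s) (sym
      (∣⇒≡ {B = 1} (ℕP.m≤n⇒m≤1+n (X<q s)) (ℕP.<-≤-trans (above-1 s) (ℕP.m≤m+n _ q))
        (on⁻ (e s , + 1) (eval-e s 1) x∈)))
    -- The sum is positive and below `2q`, so `q` is the only multiple it can be. For `sum₁` the
    -- same holds of the sum minus 1, since `X s` is at least 2.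
    Avoiding⇒∉ (sum₀ {s} {t} s<t) _ x∈ = proj₁ (sums s<t)
      (∣⇒≡+q {B = 0} (ℕP.<-≤-trans (ℕP.≤-trans (s≤s z≤n) (above-1 s)) (ℕP.m≤m+n _ (X t))) (ℕP.+-mono-< (X<q s) (X<q t))
        (on⁻ (e s ⊕ e t , + 0) (eval-sum s t 0) x∈))
    Avoiding⇒∉ (sum₁ {s} {t} s<t) _ x∈ = proj₂ (sums s<t)
      (∣⇒≡+q {B = 1} (ℕP.<-≤-trans (above-1 s) (ℕP.m≤m+n _ (X t))) (ℕP.+-mono-< (X<q s) (X<q t))
        (on⁻ (e s ⊕ e t , + 1) (eval-sum s t 1) x∈))
    Avoiding⇒∉ (diff₀ {s} {t} s<t) _ x∈ = distinct s<t (trans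
      (∣⇒≡ {B = X t + 0} (ℕP.<-≤-trans (X<q s) (ℕP.m≤n+m q _))
        (subst (_< X s + q) (sym (ℕP.+-identityʳ (X t))) (ℕP.<-≤-trans (X<q t) (ℕP.m≤n+m q _)))
        (on⁻ (e s ⊖ e t , + 0) (eval-diff s t 0) x∈))
      (ℕP.+-identityʳ (X t)))
    Avoiding⇒∉ (diff₁ {s} {t} s<t) H≢ x∈ = no-step s<t (λ { (refl , refl) → H≢ refl }) (trans
      (∣⇒≡ {B = X t + 1} (ℕP.<-≤-trans (X<q s) (ℕP.m≤n+m q _))
        (subst (_< X s + q) (ℕP.+-comm 1 (X t)) (ℕP.+-mono-≤-< (ℕP.<⇒≤ (above-1 s)) (X<q t)))
        (on⁻ (e s ⊖ e t , + 1) (eval-diff s t 1) x∈))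
      (ℕP.+-comm (X t) 1))

    Avoiding⇒avoids : All (λ H → ¬ x ∈q H) (shiBminus m (hypDiff1 i j))
    Avoiding⇒avoids = All.tabulate λ H∈ →
      let H∈shi , H≢ = ∈-filter⁻ (λ H′ → ¬? (hypDec H′ (hypDiff1 i j))) {xs = shiB m} H∈ in Avoiding⇒∉ (∈-shiB⁻ H∈shi) H≢

charQP-size : ∀ {i j : Fin m} → toℕ i < toℕ j →
  HasSize {A = Vec (Fin q) m} (λ x → Avoiding q i j (toℕ ∘ lookup x)) (charQP m (hypDiff1 i j) q)
charQP-size {m} {q} {i} {j} i<j = record
  { elements = filter ∈H? (filter avoids? (points q m))
  ; unique   = Unique.filter⁺ ∈H? (Unique.filter⁺ avoids? (points-unique q m))
  ; sound    = λ {x} x∈ →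
      let x∈′ , x∈H = ∈-filter⁻ ∈H? {xs = filter avoids? (points q m)} x∈
          _ , avoids = ∈-filter⁻ avoids? {xs = points q m} x∈′
      in avoids⇒Avoiding i<j x avoids x∈H
  ; complete = λ {x} a → ∈-filter⁺ ∈H? (∈-filter⁺ avoids? (∈-points x) (Avoiding⇒avoids i<j x a)) (Avoiding⇒∈ i<j x a)
  ; size     = refl
  }
  where
  ∈H? = λ (x : Vec (Fin q) m) → ∈q? x (hypDiff1 i j)
  avoids? = λ (x : Vec (Fin q) m) → avoidsAll? x (shiBminus m (hypDiff1 i j))

-- The formula

halving : ∀ d → ∃ λ r → ∃ λ c → c ≤ 1 × d ≡ r + (r + c)
halving zero          = 0 , 0 , z≤n , refl
halving (suc zero)    = 0 , 1 , s≤s z≤n , refl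
halving (suc (suc d)) with r , c , c≤1 , refl ← halving d =
  suc r , c , c≤1 , cong suc (sym (ℕP.+-suc r (r + c)))

pos-^ : ∀ a k → + (a ^ k) ≡ (+ a) ℤ.^ k
pos-^ a zero    = refl
pos-^ a (suc k) = trans (ℤP.pos-* a (a ^ k)) (cong (λ z → + a ℤ.* z) (pos-^ a k))

-- Halving `w` yields `r` and the parity `c`; then `w + 2 * m` is `2n + c` for `n = m + r`, which is
-- positive because `Fin m` is inhabited. Both counts now concern the same configurations.
charQP-formula : ∀ {i j : Fin m} → toℕ i < toℕ j → ∀ w →
  charQP m (hypDiff1 i j) (w + 2 * m) ≡ w ^ (m + toℕ i ∸ toℕ j) * suc w ^ (toℕ j ∸ toℕ i ∸ 1)
charQP-formula {m@(suc m′)} {i} {j} i<j w with r , c , c≤1 , refl ← halving w =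
  trans (cong (charQP m (hypDiff1 i j)) (rearrange m r c)) (HasSize-functional
    (Avoiding-size c≤1 (s≤s z≤n) i<j (charQP-size i<j))
    (valid-size c≤1 r m toℕ id i j i<j))
  where
  rearrange : ∀ m r c → r + (r + c) + 2 * m ≡ m + r + (m + r) + c
  rearrange = ℕSolver.solve-∀

theorem6p1 : (m : ℕ) (i j : Fin m) → toℕ i < toℕ j →
    ∃ λ N → (q : ℕ) → N ≤ q →
    + charQP m (hypDiff1 i j) q
    ≡ ((+ q ℤ.- + (2 * m)) ℤ.^ (m + toℕ i ∸ toℕ j))
    ℤ.* ((+ q ℤ.- + (2 * m) ℤ.+ + 1) ℤ.^ (toℕ j ∸ toℕ i ∸ 1))
-- From `q = 2m` on, `q - 2m` is a natural number and can serve as `w`.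
theorem6p1 m i j i<j = 2 * m , λ q 2m≤q → begin
  + charQP m (hypDiff1 i j) q                          ≡⟨ cong (λ q → + charQP m (hypDiff1 i j) q) (ℕP.m∸n+n≡m 2m≤q) ⟨
  + charQP m (hypDiff1 i j) (q ∸ 2 * m + 2 * m)        ≡⟨ cong +_ (charQP-formula i<j (q ∸ 2 * m)) ⟩
  + ((q ∸ 2 * m) ^ a * suc (q ∸ 2 * m) ^ b)            ≡⟨ ℤP.pos-* ((q ∸ 2 * m) ^ a) (suc (q ∸ 2 * m) ^ b) ⟩
  + ((q ∸ 2 * m) ^ a) ℤ.* + (suc (q ∸ 2 * m) ^ b)      ≡⟨ cong₂ ℤ._*_ (pos-^ (q ∸ 2 * m) a) (pos-^ (suc (q ∸ 2 * m)) b) ⟩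
  (+ (q ∸ 2 * m)) ℤ.^ a ℤ.* (+ suc (q ∸ 2 * m)) ℤ.^ b  ≡⟨ cong₂ (λ u v → u ℤ.^ a ℤ.* v ℤ.^ b) (w≡ 2m≤q) (1+w≡ 2m≤q) ⟩
  (+ q ℤ.- + (2 * m)) ℤ.^ a ℤ.* (+ q ℤ.- + (2 * m) ℤ.+ + 1) ℤ.^ b ∎
  where
  open ≡-Reasoning
  a = m + toℕ i ∸ toℕ j
  b = toℕ j ∸ toℕ i ∸ 1
  w≡ : ∀ {q} → 2 * m ≤ q → + (q ∸ 2 * m) ≡ + q ℤ.- + (2 * m)
  w≡ {q} 2m≤q = sym (trans (ℤP.m-n≡m⊖n q (2 * m)) (ℤP.⊖-≥ 2m≤q))
  1+w≡ : ∀ {q} → 2 * m ≤ q → + suc (q ∸ 2 * m) ≡ + q ℤ.- + (2 * m) ℤ.+ + 1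
  1+w≡ {q} 2m≤q = trans (cong +_ (ℕP.+-comm 1 (q ∸ 2 * m))) (cong (λ z → z ℤ.+ + 1) (w≡ 2m≤q))
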